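{- Let $1\le t\le n$ and let $G$ be a finite directed acyclic graph with $t$ inputs, one of which is a distinguished input $s$, and $n$ outputs, such that $G$ is a $(t,n)$-concentrator and the graph obtained from $G$ by removing $s$ is a $(t-1,n)$-concentrator. For a finite field $\mathbb{F}_q$, convert $G$ into an arithmetic circuit over $\mathbb{F}_q$ by replacing each non-input vertex with a weighted addition gate, where the coefficients (one for each edge of $G$) are chosen independently and uniformly at random from $\mathbb{F}_q$. If $q$ is sufficiently large, then with high probability the resulting circuit computes the $n$ shares of a $(t,n)$-threshold secret sharing scheme (with the secret placed at input $s$ and uniformly random field elements at the other $t-1$ inputs). That is: for every $\eta>0$ there is $q_0$ (depending on $G$ and $\eta$) such that for every prime power $q\ge q_0$ this holds with probability at least $1-\eta$ over the choice of the coefficients.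
   Context: $(t,n)$-concentrator ($t\le n$): a directed acyclic graph with $t$ inputs and $n$ outputs in which for every set $T$ of $t$ outputs there are $t$ pairwise vertex-disjoint directed paths connecting $t$ distinct inputs to the vertices of $T$. Input vertices have no incoming edges. Weighted addition gate: a gate with in-coming values $x_1,\dots,x_m$ that outputs $\sum_{i=1}^m c_i x_i$, where $c_1,\dots,c_m$ are fixed coefficients attached to the incoming edges. Computing the shares of a $(t,n)$-threshold secret sharing scheme: let $S$ (the value at input $s$) be a random element uniform over $\mathbb{F}_q$, let the values at the other $t-1$ inputs be uniform over $\mathbb{F}_q$, with all inputs mutually independent, and let $Y_1,\dots,Y_n$ be the values of the $n$ outputs (the shares). For $T\subseteq[n]$ let $Y_T=(Y_i)_{i\in T}$. It is required that $H(S\mid Y_T)=0$ for every $T\subseteq[n]$ with $|T|=t$ (correctness) and $H(S\mid Y_T)=H(S)$ for every $T\subseteq[n]$ with $|T|=t-1$ (privacy), where $H$ is Shannon entropy. -}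

module Defs where

open import Algebra.Apartness.Bundles using (HeytingField; HeytingCommutativeRing)
open import Algebra.Bundles using (CommutativeRing)
import Algebra.Definitions.RawMonoid as RawMonoidDefs
import Algebra.Definitions.RawSemiring as RawSemiringDefs
open import Data.Empty using (⊥-elim)
open import Data.Fin.Base using (Fin; zero; suc; punchIn; punchOut; finToFun; funToFin)
import Data.Fin.Induction as FinInduction
open import Data.Fin.Properties
  using (_≟_; any?; punchIn-injective; punchInᵢ≢i; punchIn-punchOut; punchOut-injective)
open import Data.Fin.Subset using (Subset; inside; outside; ∣_∣; _∈_)
open import Data.Integer.Base using (+_)
import Data.Integer.Base as ℤ
import Data.Integer.Properties as ℤP
open import Data.List.Base using (List; []; _∷_; length; lookup; filter; cartesianProduct)
import Data.List.Base as List
open import Data.List.Membership.Propositional.Properties using (∈-filter⁻; ∈-lookup)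
open import Data.List.Relation.Binary.Disjoint.Propositional using (Disjoint)
open import Data.Nat.Base using (ℕ; zero; suc; _∸_; z≤n; s≤s)
import Data.Nat.Base as ℕ
import Data.Nat.Properties as ℕP
open import Data.Product.Base using (∃; Σ-syntax; _×_; _,_; proj₁; proj₂)
open import Data.Rational.Base using (ℚ; mkℚ; 0ℚ; 1ℚ; _/_; +-*-rawSemiring)
import Data.Rational.Base as ℚ
import Data.Rational.Properties as ℚP
import Data.Rational.Solver as ℚSolver
import Data.Rational.Unnormalised.Base as ℚᵘ
import Data.Rational.Unnormalised.Properties as ℚᵘP
open import Data.Sum.Base using (inj₁; inj₂)
import Data.Vec.Base as Vec
import Data.Vec.Functional as Vector
open import Function.Base using (_on_)
open import Function.Bundles using (Inverse)
open import Function.Definitions using (Injective)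
open import Induction.WellFounded using (Acc; acc; WellFounded)
open import Level using (_⊔_; 0ℓ) renaming (suc to lsuc)
open import Relation.Binary.Construct.Closure.ReflexiveTransitive using (Star; ε; _◅_)
open import Relation.Binary.Construct.Closure.Transitive
  using (TransClosure; [_]; _∷_; _++_; wellFounded⁻)
open import Relation.Binary.Core using (Rel)
open import Relation.Binary.Definitions using (Decidable)
open import Relation.Binary.PropositionalEquality
  using (_≡_; _≢_; refl; sym; trans; cong; subst; resp₂; isEquivalence)
import Relation.Binary.PropositionalEquality.Properties as ≡
open import Relation.Binary.Structures using (IsStrictPartialOrder)
open import Relation.Nullary using (¬_; Dec; yes; no)
open import Relation.Nullary.Decidable using (_×-dec_)

open RawSemiringDefs +-*-rawSemiring using () renaming (_^_ to _^ℚ_)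

private
  variable
    v t n k l N : ℕ

-- Equality of real numbers is _≃_ below, not _≡_.

record ℝ : Set where
  field
    seq    : ℕ → ℚ
    cauchy : ∀ δ → 0ℚ ℚ.< δ →
             ∃ λ M → ∀ {i j} → M ℕ.≤ i → M ℕ.≤ j → ℚ.∣ seq i ℚ.- seq j ∣ ℚ.≤ δ

module Real where

  open ℝ
  open ℚSolver.+-*-Solver using (solve; con; _:=_; _:+_; _:*_; _:-_; :-_)

  infix  4 _≃_ _≤_ _<_
  infixl 6 _+_ _-_
  infixr 7 _·_

  _≃_ : ℝ → ℝ → Set
  x ≃ y = ∀ δ → 0ℚ ℚ.< δ →
          ∃ λ M → ∀ {i} → M ℕ.≤ i → ℚ.∣ seq x i ℚ.- seq y i ∣ ℚ.≤ δ

  _≤_ : ℝ → ℝ → Set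
  x ≤ y = ∀ δ → 0ℚ ℚ.< δ →
          ∃ λ M → ∀ {i} → M ℕ.≤ i → seq x i ℚ.≤ seq y i ℚ.+ δ

  _<_ : ℝ → ℝ → Set
  x < y = Σ[ δ ∈ ℚ ] 0ℚ ℚ.< δ ×
          ∃ λ M → ∀ {i} → M ℕ.≤ i → seq x i ℚ.+ δ ℚ.≤ seq y i

  private

    ∣p-p∣≤ : ∀ p {δ} → 0ℚ ℚ.< δ → ℚ.∣ p ℚ.- p ∣ ℚ.≤ δ
    ∣p-p∣≤ p 0<δ rewrite ℚP.+-inverseʳ p = ℚP.<⇒≤ 0<δ

    half-pos : ∀ {δ} → 0ℚ ℚ.< δ → 0ℚ ℚ.< δ ℚ.* ℚ.½
    half-pos {δ} 0<δ =
      subst (ℚ._< δ ℚ.* ℚ.½) (ℚP.*-zeroˡ ℚ.½) (ℚP.*-monoˡ-<-pos ℚ.½ 0<δ)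

    halves : ∀ δ → δ ℚ.* ℚ.½ ℚ.+ δ ℚ.* ℚ.½ ≡ δ
    halves δ = trans (sym (ℚP.*-distribˡ-+ δ ℚ.½ ℚ.½)) (ℚP.*-identityʳ δ)

  fromℚ : ℚ → ℝ
  fromℚ p = record { seq = λ _ → p ; cauchy = λ _ 0<δ → 0 , λ _ _ → ∣p-p∣≤ p 0<δ }

  0ℝ 1ℝ : ℝ
  0ℝ = fromℚ 0ℚ
  1ℝ = fromℚ 1ℚ

  _+_ : ℝ → ℝ → ℝ
  x + y = record { seq = λ i → seq x i ℚ.+ seq y i ; cauchy = c }
    where
    interchange : ∀ a b a′ b′ →
      (a ℚ.+ b) ℚ.- (a′ ℚ.+ b′) ≡ (a ℚ.- a′) ℚ.+ (b ℚ.- b′)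
    interchange = solve 4
      (λ a b a′ b′ → (a :+ b) :- (a′ :+ b′) := (a :- a′) :+ (b :- b′)) refl
    c : ∀ δ → 0ℚ ℚ.< δ → _
    c δ 0<δ with cauchy x _ (half-pos 0<δ) | cauchy y _ (half-pos 0<δ)
    ... | M₁ , h₁ | M₂ , h₂ = M₁ ℕ.⊔ M₂ , λ {i} {j} p q → begin
        ℚ.∣ (seq x i ℚ.+ seq y i) ℚ.- (seq x j ℚ.+ seq y j) ∣
          ≡⟨ cong ℚ.∣_∣ (interchange (seq x i) (seq y i) (seq x j) (seq y j)) ⟩
        ℚ.∣ (seq x i ℚ.- seq x j) ℚ.+ (seq y i ℚ.- seq y j) ∣
          ≤⟨ ℚP.∣p+q∣≤∣p∣+∣q∣ (seq x i ℚ.- seq x j) (seq y i ℚ.- seq y j) ⟩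
        ℚ.∣ seq x i ℚ.- seq x j ∣ ℚ.+ ℚ.∣ seq y i ℚ.- seq y j ∣
          ≤⟨ ℚP.+-mono-≤
               (h₁ (ℕP.≤-trans (ℕP.m≤m⊔n M₁ M₂) p) (ℕP.≤-trans (ℕP.m≤m⊔n M₁ M₂) q))
               (h₂ (ℕP.≤-trans (ℕP.m≤n⊔m M₁ M₂) p) (ℕP.≤-trans (ℕP.m≤n⊔m M₁ M₂) q)) ⟩
        δ ℚ.* ℚ.½ ℚ.+ δ ℚ.* ℚ.½
          ≡⟨ halves δ ⟩
        δ ∎
      where open ℚP.≤-Reasoning

  _·_ : ℚ → ℝ → ℝ
  p · x = record { seq = λ i → p ℚ.* seq x i ; cauchy = c }
    where
    B : ℚ
    B = 1ℚ ℚ.+ ℚ.∣ p ∣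
    0<B : 0ℚ ℚ.< B
    0<B = ℚP.<-≤-trans (ℚP.positive⁻¹ 1ℚ)
            (subst (ℚ._≤ B) (ℚP.+-identityʳ 1ℚ) (ℚP.+-monoʳ-≤ 1ℚ (ℚP.0≤∣p∣ p)))
    ∣p∣≤B : ℚ.∣ p ∣ ℚ.≤ B
    ∣p∣≤B = subst (ℚ._≤ B) (ℚP.+-identityˡ ℚ.∣ p ∣)
              (ℚP.+-monoˡ-≤ ℚ.∣ p ∣ (ℚP.<⇒≤ (ℚP.positive⁻¹ 1ℚ)))
    instance
      B-pos : ℚ.Positive B
      B-pos = ℚ.positive 0<B
      B-nonZero : ℚ.NonZero B
      B-nonZero = ℚP.pos⇒nonZero B
      1/B-pos : ℚ.Positive (ℚ.1/ B)
      1/B-pos = ℚP.1/pos⇒pos B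
      B-nonNeg : ℚ.NonNegative B
      B-nonNeg = ℚP.pos⇒nonNeg B
    factor : ∀ a b → p ℚ.* a ℚ.- p ℚ.* b ≡ p ℚ.* (a ℚ.- b)
    factor a b = solve 3 (λ p a b → p :* a :- p :* b := p :* (a :- b)) refl p a b
    c : ∀ δ → 0ℚ ℚ.< δ → _
    c δ 0<δ with cauchy x (ℚ.1/ B ℚ.* δ)
                   (subst (ℚ._< ℚ.1/ B ℚ.* δ) (ℚP.*-zeroʳ (ℚ.1/ B))
                     (ℚP.*-monoʳ-<-pos (ℚ.1/ B) 0<δ))
    ... | M , h = M , λ {i} {j} q r → begin
        ℚ.∣ p ℚ.* seq x i ℚ.- p ℚ.* seq x j ∣
          ≡⟨ cong ℚ.∣_∣ (factor (seq x i) (seq x j)) ⟩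
        ℚ.∣ p ℚ.* (seq x i ℚ.- seq x j) ∣
          ≡⟨ ℚP.∣p*q∣≡∣p∣*∣q∣ p _ ⟩
        ℚ.∣ p ∣ ℚ.* ℚ.∣ seq x i ℚ.- seq x j ∣
          ≤⟨ ℚP.*-monoʳ-≤-nonNeg _ {{ℚP.∣-∣-nonNeg (seq x i ℚ.- seq x j)}} ∣p∣≤B ⟩
        B ℚ.* ℚ.∣ seq x i ℚ.- seq x j ∣
          ≤⟨ ℚP.*-monoˡ-≤-nonNeg B (h q r) ⟩
        B ℚ.* (ℚ.1/ B ℚ.* δ)
          ≡⟨ sym (ℚP.*-assoc B (ℚ.1/ B) δ) ⟩
        (B ℚ.* ℚ.1/ B) ℚ.* δ
          ≡⟨ cong (ℚ._* δ) (ℚP.*-inverseʳ B) ⟩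
        1ℚ ℚ.* δ
          ≡⟨ ℚP.*-identityˡ δ ⟩
        δ ∎
      where open ℚP.≤-Reasoning

  _-_ : ℝ → ℝ → ℝ
  x - y = x + (ℚ.- 1ℚ) · y

  ∑ : (Fin k → ℝ) → ℝ
  ∑ = Vector.foldr _+_ 0ℝ

  mercator : ℚ → ℕ → ℚ
  mercator z zero    = 0ℚ
  mercator z (suc i) = mercator z i ℚ.+ z ^ℚ suc i ℚ.* (+ 1 / suc i)

  private
    module Mercator (p : ℚ) (0<p : 0ℚ ℚ.< p) (p≤1 : p ℚ.≤ 1ℚ) where

      open ℚP.≤-Reasoning

      z : ℚ
      z = 1ℚ ℚ.- p

      0≤z : 0ℚ ℚ.≤ z
      0≤z = subst (ℚ._≤ z) (ℚP.+-inverseʳ p) (ℚP.+-monoˡ-≤ (ℚ.- p) p≤1)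

      z≤1 : z ℚ.≤ 1ℚ
      z≤1 = subst (z ℚ.≤_) (ℚP.+-identityʳ 1ℚ)
              (ℚP.+-monoʳ-≤ 1ℚ (ℚP.neg-antimono-≤ (ℚP.<⇒≤ 0<p)))

      instance
        z-nonNeg : ℚ.NonNegative z
        z-nonNeg = ℚ.nonNegative 0≤z

      0≤z^ : ∀ i → 0ℚ ℚ.≤ z ^ℚ i
      0≤z^ zero    = ℚP.<⇒≤ (ℚP.positive⁻¹ 1ℚ)
      0≤z^ (suc i) = subst (ℚ._≤ z ^ℚ suc i) (ℚP.*-zeroʳ z) (ℚP.*-monoˡ-≤-nonNeg z (0≤z^ i))

      z^-step : ∀ i → z ^ℚ suc i ℚ.≤ z ^ℚ i
      z^-step i = subst (z ^ℚ suc i ℚ.≤_) (ℚP.*-identityˡ (z ^ℚ i))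
                    (ℚP.*-monoʳ-≤-nonNeg (z ^ℚ i) {{ℚ.nonNegative (0≤z^ i)}} z≤1)

      z^-drop : ∀ m d → z ^ℚ suc (m ℕ.+ d) ℚ.≤ z ^ℚ d
      z^-drop zero    d = z^-step d
      z^-drop (suc m) d = ℚP.≤-trans (z^-step (suc (m ℕ.+ d))) (z^-drop m d)

      0≤1/ : ∀ i → 0ℚ ℚ.≤ + 1 / suc i
      0≤1/ i = ℚP.nonNegative⁻¹ (+ 1 / suc i) {{ℚP.normalize-nonNeg 1 (suc i)}}

      0≤term : ∀ i → 0ℚ ℚ.≤ z ^ℚ suc i ℚ.* (+ 1 / suc i)
      0≤term i = subst (ℚ._≤ z ^ℚ suc i ℚ.* (+ 1 / suc i)) (ℚP.*-zeroʳ (z ^ℚ suc i))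
        (ℚP.*-monoˡ-≤-nonNeg (z ^ℚ suc i) {{ℚ.nonNegative (0≤z^ (suc i))}} (0≤1/ i))

      mono : ∀ m d → mercator z m ℚ.≤ mercator z (m ℕ.+ d)
      mono m zero    rewrite ℕP.+-identityʳ m = ℚP.≤-refl
      mono m (suc d) rewrite ℕP.+-suc m d = begin
        mercator z m                ≤⟨ mono m d ⟩
        mercator z (m ℕ.+ d)        ≡⟨ sym (ℚP.+-identityʳ _) ⟩
        mercator z (m ℕ.+ d) ℚ.+ 0ℚ ≤⟨ ℚP.+-monoʳ-≤ (mercator z (m ℕ.+ d)) (0≤term (m ℕ.+ d)) ⟩
        mercator z (suc (m ℕ.+ d))  ∎

      archimedes : ∀ r → 0ℚ ℚ.< r → ∃ λ M → ∀ i → M ℕ.≤ i → + 1 / suc i ℚ.≤ r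
      archimedes (mkℚ (+ zero) _ _)    0<r = ⊥-elim (ℤP.<-irrefl refl (ℚP.drop-*<* 0<r))
      archimedes (mkℚ ℤ.-[1+ _ ] _ _)  0<r with () ← ℚP.drop-*<* 0<r
      archimedes r@(mkℚ (+ suc a) d _) 0<r = d , λ i d≤i →
        ℚP.toℚᵘ-cancel-≤
          (ℚᵘP.≤-respˡ-≃ (ℚᵘP.≃-sym (ℚP.toℚᵘ-fromℚᵘ (ℚᵘ.mkℚᵘ (+ 1) i))) (bound i d≤i))
        where
        bound : ∀ i → d ℕ.≤ i → ℚᵘ.mkℚᵘ (+ 1) i ℚᵘ.≤ ℚ.toℚᵘ r
        bound i d≤i = ℚᵘ.*≤* (ℤ.+≤+ (ℕP.*-mono-≤ {1} {suc a} (s≤s z≤n) (s≤s d≤i)))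

      instance
        p-pos : ℚ.Positive p
        p-pos = ℚ.positive 0<p

      module _ (δ : ℚ) (0<δ : 0ℚ ℚ.< δ) where

        threshold : ∃ λ M → ∀ i → M ℕ.≤ i → + 1 / suc i ℚ.≤ p ℚ.* δ
        threshold = archimedes (p ℚ.* δ)
          (subst (ℚ._< p ℚ.* δ) (ℚP.*-zeroʳ p) (ℚP.*-monoʳ-<-pos p 0<δ))

        M : ℕ
        M = proj₁ threshold

        module _ (m : ℕ) (M≤m : M ℕ.≤ m) where

          telescope : ∀ a w p →
            (a ℚ.+ δ ℚ.* (1ℚ ℚ.- w)) ℚ.+ w ℚ.* (p ℚ.* δ)
            ≡ a ℚ.+ δ ℚ.* (1ℚ ℚ.- (1ℚ ℚ.- p) ℚ.* w)
          telescope a w p = solve 4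
            (λ a w p δ → (a :+ δ :* (con 1ℚ :- w)) :+ w :* (p :* δ)
                         := a :+ δ :* (con 1ℚ :- (con 1ℚ :- p) :* w)) refl a w p δ

          upper : ∀ d → mercator z (m ℕ.+ d) ℚ.≤ mercator z m ℚ.+ δ ℚ.* (1ℚ ℚ.- z ^ℚ d)
          upper zero rewrite ℕP.+-identityʳ m | ℚP.*-zeroʳ δ | ℚP.+-identityʳ (mercator z m) =
            ℚP.≤-refl
          upper (suc d) rewrite ℕP.+-suc m d = begin
            mercator z (m ℕ.+ d) ℚ.+ z ^ℚ suc (m ℕ.+ d) ℚ.* (+ 1 / suc (m ℕ.+ d))
              ≤⟨ ℚP.+-mono-≤ (upper d) (ℚP.≤-trans
                   (ℚP.*-monoʳ-≤-nonNeg (+ 1 / suc (m ℕ.+ d))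
                     {{ℚ.nonNegative (0≤1/ (m ℕ.+ d))}} (z^-drop m d))
                   (ℚP.*-monoˡ-≤-nonNeg (z ^ℚ d) {{ℚ.nonNegative (0≤z^ d)}}
                     (proj₂ threshold (m ℕ.+ d) (ℕP.≤-trans M≤m (ℕP.m≤m+n m d))))) ⟩
            (mercator z m ℚ.+ δ ℚ.* (1ℚ ℚ.- z ^ℚ d)) ℚ.+ z ^ℚ d ℚ.* (p ℚ.* δ)
              ≡⟨ telescope (mercator z m) (z ^ℚ d) p ⟩
            mercator z m ℚ.+ δ ℚ.* (1ℚ ℚ.- z ^ℚ suc d) ∎

          close : ∀ d → mercator z (m ℕ.+ d) ℚ.- mercator z m ℚ.≤ δ
          close d = begin
            mercator z (m ℕ.+ d) ℚ.- mercator z m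
              ≤⟨ ℚP.+-monoˡ-≤ (ℚ.- mercator z m) (upper d) ⟩
            (mercator z m ℚ.+ δ ℚ.* (1ℚ ℚ.- z ^ℚ d)) ℚ.- mercator z m
              ≡⟨ simplify (mercator z m) (z ^ℚ d) ⟩
            δ ℚ.- δ ℚ.* z ^ℚ d
              ≤⟨ ℚP.+-monoʳ-≤ δ (ℚP.neg-antimono-≤
                   (subst (ℚ._≤ δ ℚ.* z ^ℚ d) (ℚP.*-zeroʳ δ)
                     (ℚP.*-monoˡ-≤-nonNeg δ {{ℚ.nonNegative (ℚP.<⇒≤ 0<δ)}} (0≤z^ d)))) ⟩
            δ ℚ.- 0ℚ
              ≡⟨ ℚP.+-identityʳ δ ⟩
            δ ∎
            where
            simplify : ∀ a w → (a ℚ.+ δ ℚ.* (1ℚ ℚ.- w)) ℚ.- a ≡ δ ℚ.- δ ℚ.* w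
            simplify a w = solve 3
              (λ a w δ → (a :+ δ :* (con 1ℚ :- w)) :- a := δ :- δ :* w) refl a w δ

        ordered : ∀ {i j} → M ℕ.≤ j → j ℕ.≤ i → ℚ.∣ mercator z i ℚ.- mercator z j ∣ ℚ.≤ δ
        ordered {i} {j} M≤j j≤i with ℕP.m≤n⇒∃[o]m+o≡n j≤i
        ... | d , refl = subst (ℚ._≤ δ) (sym (ℚP.0≤p⇒∣p∣≡p 0≤diff)) (close j M≤j d)
          where
          0≤diff : 0ℚ ℚ.≤ mercator z (j ℕ.+ d) ℚ.- mercator z j
          0≤diff = subst (ℚ._≤ mercator z (j ℕ.+ d) ℚ.- mercator z j)
                     (ℚP.+-inverseʳ (mercator z j))
                     (ℚP.+-monoˡ-≤ (ℚ.- mercator z j) (mono j d))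

        swap : ∀ a b → ℚ.∣ a ℚ.- b ∣ ≡ ℚ.∣ b ℚ.- a ∣
        swap a b = trans (sym (ℚP.∣-p∣≡∣p∣ (a ℚ.- b))) (cong ℚ.∣_∣ (flip a b))
          where
          flip : ∀ a b → ℚ.- (a ℚ.- b) ≡ b ℚ.- a
          flip = solve 2 (λ a b → :- (a :- b) := b :- a) refl

        isCauchy : ∀ {i j} → M ℕ.≤ i → M ℕ.≤ j → ℚ.∣ mercator z i ℚ.- mercator z j ∣ ℚ.≤ δ
        isCauchy {i} {j} M≤i M≤j with ℕP.≤-total j i
        ... | inj₁ j≤i = ordered M≤j j≤i
        ... | inj₂ i≤j = subst (ℚ._≤ δ) (swap (mercator z j) (mercator z i)) (ordered M≤i i≤j)

  -- Natural logarithm: -log p = Σ_{i ≥ 1} (1 - p)^i / i  for 0 < p ≤ 1.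
  -log : (p : ℚ) → 0ℚ ℚ.< p → p ℚ.≤ 1ℚ → ℝ
  -log p 0<p p≤1 = record
    { seq    = mercator (1ℚ ℚ.- p)
    ; cauchy = λ δ 0<δ → M δ 0<δ , isCauchy δ 0<δ
    }
    where open Mercator p 0<p p≤1

  -- -p log p for probabilities p, with 0 log 0 = 0 (values outside [0,1] are junk).
  -plogp : ℚ → ℝ
  -plogp p with (0ℚ ℚP.<? p) ×-dec (p ℚP.≤? 1ℚ)
  ... | yes (0<p , p≤1) = p · -log p 0<p p≤1
  ... | no _            = 0ℝ

infixl 7 _÷_

_÷_ : ℕ → ℕ → ℚ
a ÷ zero  = 0ℚ
a ÷ suc b = + a / suc b

-- Fin N is the uniform sample space.  The event A need not be decidable: it
-- has probability at least r when it contains a decidable event of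
-- probability at least r.
ℙ[_]≥_ : ∀ {a} → (Fin N → Set a) → ℝ → Set a
ℙ[_]≥_ {N} A r =
  Σ[ B ∈ Subset N ] (∀ {ω} → ω ∈ B → A ω) × r Real.≤ Real.fromℚ (∣ B ∣ ÷ N)

module _ (X : Fin N → Fin k) where

  # : Fin k → ℕ
  # x = Vec.count (λ ω → X ω ≟ x) (Vec.allFin N)

  law : Fin k → ℚ
  law x = # x ÷ N

module _ (X : Fin N → Fin k) (Y : Fin N → Fin l) where

  #₂ : Fin k → Fin l → ℕ
  #₂ x y = Vec.count (λ ω → (X ω ≟ x) ×-dec (Y ω ≟ y)) (Vec.allFin N)

  -- Division by 0 occurs only if P(Y = y) = 0, where H[ X ∣ Y ] has weight 0.
  lawGiven : Fin l → Fin k → ℚ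
  lawGiven y x = #₂ x y ÷ # Y y

entropy : (Fin k → ℚ) → ℝ
entropy p = Real.∑ λ x → Real.-plogp (p x)

H : (Fin N → Fin k) → ℝ
H X = entropy (law X)

H[_∣_] : (Fin N → Fin k) → (Fin N → Fin l) → ℝ
H[ X ∣ Y ] = Real.∑ λ y → law Y y Real.· entropy (lawGiven X Y y)

-- When the carrier is finite, the apartness _#_ of a Heyting field is just _≉_,
-- so this is a finite field in the usual sense.
record FiniteField c ℓ₁ ℓ₂ : Set (lsuc (c ⊔ ℓ₁ ⊔ ℓ₂)) where
  field
    heytingField : HeytingField c ℓ₁ ℓ₂

  open HeytingField heytingField public

  commutativeRing : CommutativeRing c ℓ₁
  commutativeRing = HeytingCommutativeRing.commutativeRing heytingCommutativeRing

  field
    order       : ℕ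
    enumeration : Inverse (≡.setoid (Fin order)) setoid

  element : Fin order → Carrier
  element = Inverse.to enumeration

  index : Carrier → Fin order
  index = Inverse.from enumeration

record Network (v t n : ℕ) : Set₁ where
  infix 4 _⟶_ _⟶?_
  field
    _⟶_              : Rel (Fin v) 0ℓ
    _⟶?_             : Decidable _⟶_
    acyclic          : ∀ {u} → ¬ TransClosure _⟶_ u u
    input            : Fin t → Fin v
    input-injective  : Injective _≡_ _≡_ input
    input-source     : ∀ {u} i → ¬ (u ⟶ input i)
    output           : Fin n → Fin v
    output-injective : Injective _≡_ _≡_ output

  edges : List (Fin v × Fin v)
  edges = filter (λ e → proj₁ e ⟶? proj₂ e)
                 (cartesianProduct (List.allFin v) (List.allFin v))

  ∣E∣ : ℕ
  ∣E∣ = length edges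

  Edge : Set
  Edge = Fin ∣E∣

  src tgt : Edge → Fin v
  src e = proj₁ (lookup edges e)
  tgt e = proj₂ (lookup edges e)

  src⟶tgt : ∀ e → src e ⟶ tgt e
  src⟶tgt e = proj₂ (∈-filter⁻ (λ e → proj₁ e ⟶? proj₂ e)
    {xs = cartesianProduct (List.allFin v) (List.allFin v)} (∈-lookup {xs = edges} e))

  ⟶-wellFounded : WellFounded _⟶_
  ⟶-wellFounded = wellFounded⁻ _⟶_ (FinInduction.spo-wellFounded isSPO)
    where
    isSPO : IsStrictPartialOrder _≡_ (TransClosure _⟶_)
    isSPO = record
      { isEquivalence = isEquivalence
      ; irrefl        = λ { refl → acyclic }
      ; trans         = _++_
      ; <-resp-≈      = resp₂ (TransClosure _⟶_)
      }

  Path : Rel (Fin v) 0ℓ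
  Path = Star _⟶_

  vertices : ∀ {u w} → Path u w → List (Fin v)
  vertices {u} ε       = u ∷ []
  vertices {u} (_ ◅ p) = u ∷ vertices p

-- The elements of T in increasing order.
members : (T : Subset n) → Fin ∣ T ∣ → Fin n
members (inside  Vec.∷ T) zero    = zero
members (inside  Vec.∷ T) (suc r) = suc (members T r)
members (outside Vec.∷ T) r       = suc (members T r)

module _ (G : Network v t n) where

  open Network G

  record Linking (T : Subset n) : Set where
    field
      start           : Fin ∣ T ∣ → Fin t
      start-injective : Injective _≡_ _≡_ start
      path            : ∀ r → Path (input (start r)) (output (members T r))
      disjoint        : ∀ {r r′} → r ≢ r′ → Disjoint (vertices (path r)) (vertices (path r′))

  IsConcentrator : Set
  IsConcentrator = ∀ (T : Subset n) → ∣ T ∣ ≡ t → Linking T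

  IsOutput : Fin v → Set
  IsOutput u = ∃ λ j → output j ≡ u

-- Deleting an input vertex, with all edges at it.  For the remaining graph to
-- have n outputs, the deleted vertex must not be one of the outputs.
deleteInput : (G : Network v t n) (s : Fin t) → ¬ IsOutput G (Network.input G s) →
              Network (v ∸ 1) (t ∸ 1) n
deleteInput {v = zero} G s _ with () ← Network.input G s
deleteInput {v = suc v} {t = suc t} {n = n} G s s-notOutput = record
  { _⟶_              = _⟶_ on punchIn s*
  ; _⟶?_             = λ u w → punchIn s* u ⟶? punchIn s* w
  ; acyclic          = λ cycle → acyclic (lift cycle)
  ; input            = λ i → punchOut (s*≢input i)
  ; input-injective  = λ eq → punchIn-injective s _ _
                         (input-injective (punchOut-injective (s*≢input _) (s*≢input _) eq))
  ; input-source     = λ {u} i u⟶i → input-source (punchIn s i)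
                         (subst (punchIn s* u ⟶_) (punchIn-punchOut (s*≢input i)) u⟶i)
  ; output           = λ j → punchOut (s*≢output j)
  ; output-injective = λ eq →
                         output-injective (punchOut-injective (s*≢output _) (s*≢output _) eq)
  }
  where
  open Network G

  s* : Fin (suc v)
  s* = input s

  s*≢input : ∀ i → s* ≢ input (punchIn s i)
  s*≢input i eq = punchInᵢ≢i s i (sym (input-injective eq))

  s*≢output : ∀ j → s* ≢ output j
  s*≢output j eq = s-notOutput (j , sym eq)

  lift : ∀ {u w} → TransClosure (_⟶_ on punchIn s*) u w →
         TransClosure _⟶_ (punchIn s* u) (punchIn s* w)
  lift [ e ]    = [ e ]
  lift (e ∷ es) = e ∷ lift es

module _ {c ℓ₁ ℓ₂} (F : FiniteField c ℓ₁ ℓ₂) (G : Network v t n) where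

  open FiniteField F using (Carrier; _*_; 0#; order; element; index)
  open Network G
  open RawMonoidDefs (CommutativeRing.+-rawMonoid (FiniteField.commutativeRing F)) using (sum)

  module _ (coeff : Edge → Carrier) where

    module _ (x : Fin t → Carrier) where

      valueAcc : ∀ w → Acc _⟶_ w → Carrier
      valueAcc w (acc rs) with any? (λ i → input i ≟ w)
      ... | yes (i , _) = x i
      ... | no _        = sum λ e → contribution e (tgt e ≟ w)
        where
        contribution : ∀ e → Dec (tgt e ≡ w) → Carrier
        contribution e (yes eq) =
          coeff e * valueAcc (src e) (rs (subst (src e ⟶_) eq (src⟶tgt e)))
        contribution e (no _)   = 0#

      value : Fin v → Carrier
      value w = valueAcc w (⟶-wellFounded w)

    -- A sample ω : Fin (order ^ t) encodes independent uniform values at the t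
    -- inputs; random variables are encoded with values in Fin via index and funToFin.

    inputValues : Fin (order ℕ.^ t) → Fin t → Carrier
    inputValues ω i = element (finToFun ω i)

    secret : Fin t → Fin (order ℕ.^ t) → Fin order
    secret s ω = index (inputValues ω s)

    shares : (T : Subset n) → Fin (order ℕ.^ t) → Fin (order ℕ.^ ∣ T ∣)
    shares T ω = funToFin λ r → index (value (inputValues ω) (output (members T r)))

    record ComputesThresholdScheme (s : Fin t) : Set where
      field
        correctness : ∀ T → ∣ T ∣ ≡ t     → H[ secret s ∣ shares T ] Real.≃ Real.0ℝ
        privacy     : ∀ T → ∣ T ∣ ≡ t ∸ 1 → H[ secret s ∣ shares T ] Real.≃ H (secret s)

  -- Independent uniform coefficients, one for each edge.
  coefficients : Fin (order ℕ.^ ∣E∣) → Edge → Carrier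
  coefficients ω e = element (finToFun ω e)

{-# OPTIONS --safe #-}

-- Fix t vertex-disjoint paths from the inputs to the outputs in T. Walking along them
-- from the inputs, one vertex at a time in topological order, one keeps a frontier of t
-- vertices (one on each path) whose values determine the inputs. Let the frontier advance
-- along the edge e = (u , w). By bijectivity there is exactly one input vector x₀ with value
-- 1 at u and 0 on the rest of the frontier, and the new frontier still determines the
-- inputs unless w has value 0 at x₀. The coefficient of e enters that value with factor 1
-- and influences nothing computed before, so at most one of its q values is bad.
-- Hence the bad coefficient vectors for T lie in at most L hyperplane-sized sets, L the
-- total length of the paths, which is a fraction L / q of the space.
--
-- For |T| = t this gives correctness. For |T| = t - 1 it is applied to the paths that avoid
-- s: the secret and the shares in T together determine the inputs, so by counting they
-- are in bijection with them, and the secret is independent of the shares.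

module Submission where

open import Defs
open import Algebra.Bundles using (CommutativeRing; Ring)
import Algebra.Definitions.RawSemiring as RawSemiringDefs
import Algebra.Properties.Ring as RingProperties
import Algebra.Properties.Semiring.Sum as SemiringSum
open import Data.Empty using (⊥-elim)
open import Data.Fin.Base
  using (Fin; zero; suc; punchIn; punchOut; finToFun; funToFin; join; splitAt; combine)
open import Data.Fin.Properties
  using (_≟_; any?; all?; suc-injective; punchIn-injective; punchInᵢ≢i; punchIn-punchOut;
         punchOut-injective; injective⇒≤; splitAt-join; combine-injective;
         funToFin-finToFin; finToFun-funToFin)
open import Data.Fin.Subset using (Subset; inside; outside; ∣_∣; _∈_; ∁)
open import Data.Fin.Subset.Properties using (∣∁p∣≡n∸∣p∣; x∈∁p⇒x∉p; ∣p∣≤n; anySubset?)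
import Data.Integer.Base as ℤ
import Data.Integer.Properties as ℤP
import Data.Integer.Solver as ℤSolver
open import Data.List.Membership.Propositional using () renaming (_∈_ to _∈ₗ_)
open import Data.List.Membership.Propositional.Properties
  using (∈-filter⁺; ∈-cartesianProduct⁺; ∈-allFin)
import Data.List.Relation.Unary.Any as Any
open import Data.List.Relation.Unary.Any.Properties using (lookup-index)
open import Data.Nat.Base using (ℕ; zero; suc; _∸_; _^_; _⊔_; _≤_; _<_; z≤n; s≤s)
import Data.Nat.Base as ℕ
import Data.Nat.Properties as ℕP
open import Data.Product.Base using (∃; _×_; _,_; proj₁; proj₂; map₂; swap)
open import Data.Rational.Base using (ℚ; mkℚ; 0ℚ; 1ℚ)
import Data.Rational.Base as ℚ
import Data.Rational.Properties as ℚP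
import Data.Rational.Unnormalised.Base as ℚᵘ
import Data.Rational.Unnormalised.Properties as ℚᵘP
open import Data.Sum.Base using (_⊎_; inj₁; inj₂)
open import Data.Sum.Properties using (inj₁-injective; inj₂-injective)
open import Data.Unit.Base using (⊤; tt)
open import Data.Vec.Base as Vec using (Vec; []; _∷_; here; there; tabulate; count)
open import Data.Vec.Properties using (lookup∘tabulate; lookup⇒[]=; []=⇒lookup)
import Data.Vec.Functional as Vector
open import Function.Base using (_∘_; id)
open import Function.Bundles using (Inverse)
open import Function.Definitions using (Injective)
open import Induction.WellFounded using (Acc; acc; module FixPoint; module All)
open import Level using (Level; 0ℓ)
open import Relation.Binary.Construct.Closure.ReflexiveTransitive using (ε; _◅_)
open import Relation.Binary.PropositionalEquality
  using (_≡_; _≢_; refl; sym; trans; cong; cong₂; subst; subst₂; module ≡-Reasoning)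
import Relation.Binary.Reasoning.Setoid as SetoidReasoning
open import Relation.Nullary using (¬_; Dec; yes; no; does; contradiction)
open import Relation.Nullary.Decidable
  using (map′; decidable-stable; dec-true; ¬?; _×-dec_; _⊎-dec_; _→-dec_)
open import Relation.Unary using (Decidable)

open SemiringSum ℕP.+-*-semiring
  using () renaming (sum to sumℕ; sum-cong-≗ to sumℕ-cong;
                     sum-replicate-zero to sumℕ-zero; ∑-distrib-+ to sumℕ-+)
open SemiringSum (Ring.semiring ℚP.+-*-ring)
  using () renaming (sum to sumℚ; sum-cong-≗ to sumℚ-cong;
                     sum-replicate-zero to sumℚ-zero; *-distribʳ-sum to sumℚ-*ʳ)
open RawSemiringDefs ℚ.+-*-rawSemiring using () renaming (_^_ to _^ℚ_)
open ℝ using (seq)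

private
  variable
    v t n m k l N : ℕ

-- Finite sets and counting

-- Pigeonhole: punching out a missed value would squeeze `Fin (suc n)` injectively into `Fin n`.
injective⇒surjective : (f : Fin n → Fin n) → Injective _≡_ _≡_ f → ∀ y → ∃ λ x → f x ≡ y
injective⇒surjective {suc n} f inj y with any? (λ x → f x ≟ y)
... | yes found = found
... | no missed = contradiction (injective⇒≤ squeezed-injective) ℕP.1+n≰n
  where
  y≢f : ∀ x → y ≢ f x
  y≢f x eq = missed (x , sym eq)
  squeezed : Fin (suc n) → Fin n
  squeezed x = punchOut (y≢f x)
  squeezed-injective : Injective _≡_ _≡_ squeezed
  squeezed-injective eq = inj (punchOut-injective (y≢f _) (y≢f _) eq)

injective⇒surjective′ : m ≡ n → (f : Fin m → Fin n) → Injective _≡_ _≡_ f →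
  ∀ y → ∃ λ x → f x ≡ y
injective⇒surjective′ refl = injective⇒surjective

finToFun-injective : ∀ {ω ω′ : Fin (k ^ n)} →
  (∀ i → finToFun {k} {n} ω i ≡ finToFun ω′ i) → ω ≡ ω′
finToFun-injective {k} {n} {ω} {ω′} eq = begin
  ω                              ≡⟨ funToFin-finToFin {n} {k} ω ⟨
  funToFin (finToFun {k} {n} ω)  ≡⟨ funToFin-cong eq ⟩
  funToFin (finToFun {k} {n} ω′) ≡⟨ funToFin-finToFin {n} {k} ω′ ⟩
  ω′                             ∎
  where
  open ≡-Reasoning
  funToFin-cong : ∀ {n} {f g : Fin n → Fin k} → (∀ i → f i ≡ g i) → funToFin f ≡ funToFin g
  funToFin-cong {zero}  eq = refl
  funToFin-cong {suc n} eq = cong₂ combine (eq zero) (funToFin-cong (eq ∘ suc))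

funToFin-injective : {f g : Fin n → Fin k} → funToFin f ≡ funToFin g → ∀ i → f i ≡ g i
funToFin-injective {f = f} {g} eq i = begin
  f i                     ≡⟨ finToFun-funToFin f i ⟨
  finToFun (funToFin f) i ≡⟨ cong (λ z → finToFun z i) eq ⟩
  finToFun (funToFin g) i ≡⟨ finToFun-funToFin g i ⟩
  g i                     ∎
  where open ≡-Reasoning

members-injective : (T : Subset n) → Injective _≡_ _≡_ (members T)
members-injective (inside  ∷ T) {zero}  {zero}  eq = refl
members-injective (inside  ∷ T) {suc r} {suc s} eq =
  cong suc (members-injective T (suc-injective eq))
members-injective (outside ∷ T) eq = members-injective T (suc-injective eq)

members-∈ : (T : Subset n) (r : Fin ∣ T ∣) → members T r ∈ T
members-∈ (inside  ∷ T) zero    = here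
members-∈ (inside  ∷ T) (suc r) = there (members-∈ T r)
members-∈ (outside ∷ T) r       = there (members-∈ T r)

sumSubsets : (Subset n → ℕ) → ℕ
sumSubsets {zero}  f = f []
sumSubsets {suc n} f = sumSubsets (f ∘ (inside ∷_)) ℕ.+ sumSubsets (f ∘ (outside ∷_))

sumSubsets-*ʳ : ∀ c (f : Subset n → ℕ) → sumSubsets (λ T → f T ℕ.* c) ≡ sumSubsets f ℕ.* c
sumSubsets-*ʳ {zero}  c f = refl
sumSubsets-*ʳ {suc n} c f = trans
  (cong₂ ℕ._+_ (sumSubsets-*ʳ c (f ∘ (inside ∷_))) (sumSubsets-*ʳ c (f ∘ (outside ∷_))))
  (sym (ℕP.*-distribʳ-+ c (sumSubsets (f ∘ (inside ∷_))) _))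

-- An injection instead of a count, so that P need not be decidable.
AtMost : ∀ {K a} → ℕ → (Fin K → Set a) → Set a
AtMost N P = ∃ λ (g : ∀ ω → P ω → Fin N) →
  ∀ {ω ω′} (p : P ω) (p′ : P ω′) → g ω p ≡ g ω′ p′ → ω ≡ ω′

module _ {K : ℕ} where

  AtMost-empty : ∀ {a} {P : Fin K → Set a} → (∀ ω → ¬ P ω) → AtMost 0 P
  AtMost-empty ¬P = (λ ω p → contradiction p (¬P ω)) , λ p _ _ → contradiction p (¬P _)

  AtMost-⊆ : ∀ {a b} {P : Fin K → Set a} {Q : Fin K → Set b} →
    (∀ ω → P ω → Q ω) → AtMost N Q → AtMost N P
  AtMost-⊆ P⊆Q (g , inj) = (λ ω p → g ω (P⊆Q ω p)) , λ p p′ → inj (P⊆Q _ p) (P⊆Q _ p′)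

  -- A point of both sets may receive two codes, one from each kind of proof. That is harmless: only
  -- equal codes have to come from equal points.
  AtMost-∪ : ∀ {a b} {P : Fin K → Set a} {Q : Fin K → Set b} →
    AtMost m P → AtMost n Q → AtMost (m ℕ.+ n) (λ ω → P ω ⊎ Q ω)
  AtMost-∪ {m} {n} {P = P} {Q} (g , g-inj) (h , h-inj) =
    (λ ω pq → join m n (code ω pq)) ,
    λ pq pq′ eq → decode pq pq′ (begin
      code _ pq                         ≡⟨ splitAt-join m n _ ⟨
      splitAt m (join m n (code _ pq))  ≡⟨ cong (splitAt m) eq ⟩
      splitAt m (join m n (code _ pq′)) ≡⟨ splitAt-join m n _ ⟩
      code _ pq′                        ∎)
    where
    open ≡-Reasoning
    code : ∀ ω → P ω ⊎ Q ω → Fin m ⊎ Fin n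
    code ω (inj₁ p) = inj₁ (g ω p)
    code ω (inj₂ q) = inj₂ (h ω q)
    decode : ∀ {ω ω′} pq pq′ → code ω pq ≡ code ω′ pq′ → ω ≡ ω′
    decode (inj₁ p) (inj₁ p′) eq with refl ← g-inj p p′ (inj₁-injective eq) = refl
    decode (inj₂ q) (inj₂ q′) eq with refl ← h-inj q q′ (inj₂-injective eq) = refl

  -- The union bound. The family of subsets is halved by membership of the first element, which is
  -- the recursion of `sumSubsets`.
  AtMost-⋃ : ∀ {a} (f : Subset n → ℕ) {P : Subset n → Fin K → Set a} →
    (∀ T → AtMost (f T) (P T)) → AtMost (sumSubsets f) (λ ω → ∃ λ T → P T ω)
  AtMost-⋃ {zero}  f small = AtMost-⊆ (λ { ω ([] , p) → p }) (small [])
  AtMost-⋃ {suc n} f small = AtMost-⊆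
    (λ { ω (inside ∷ T , p) → inj₁ (T , p) ; ω (outside ∷ T , p) → inj₂ (T , p) })
    (AtMost-∪ (AtMost-⋃ _ (small ∘ (inside ∷_))) (AtMost-⋃ _ (small ∘ (outside ∷_))))

  -- Turns a code into a cardinality: `members B` lists `B` without repetition, so coding the listed
  -- points is injective.
  ∣_∣≤ : ∀ {a} {P : Fin K → Set a} (B : Subset K) → (∀ {ω} → ω ∈ B → P ω) →
    AtMost N P → ∣ B ∣ ≤ N
  ∣_∣≤ B B⊆P (g , inj) = injective⇒≤ λ {r} {r′} eq →
    members-injective B (inj (B⊆P (members-∈ B r)) (B⊆P (members-∈ B r′)) eq)

  subset : ∀ {a} {P : Fin K → Set a} → (∀ ω → Dec (P ω)) → Subset K
  subset P? = tabulate (λ ω → does (P? ω))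

  ∈-subset⁻ : ∀ {a} {P : Fin K → Set a} (P? : ∀ ω → Dec (P ω)) {ω} → ω ∈ subset P? → P ω
  ∈-subset⁻ P? {ω} ω∈
    with P? ω | trans (sym (lookup∘tabulate (λ ω → does (P? ω)) ω)) ([]=⇒lookup ω∈)
  ... | yes p | _ = p

  ∈-subset⁺ : ∀ {a} {P : Fin K → Set a} (P? : ∀ ω → Dec (P ω)) {ω} → P ω → ω ∈ subset P?
  ∈-subset⁺ P? {ω} p =
    lookup⇒[]= ω _ (trans (lookup∘tabulate (λ ω → does (P? ω)) ω) (dec-true (P? ω) p))

-- The number of points of a coordinate hyperplane in a space with q ^ E points,
-- with 0 when there is no coordinate.
hyperplane : ℕ → ℕ → ℕ
hyperplane q zero    = 0
hyperplane q (suc E) = q ^ E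

-- The remaining coordinates determine the point, since they determine coordinate e.
AtMost-coordinate : ∀ {a E q} (e : Fin E) {P : Fin (q ^ E) → Set a} →
  (∀ {ω ω′} → P ω → P ω′ →
    (∀ i → i ≢ e → finToFun {q} {E} ω i ≡ finToFun ω′ i) →
    finToFun {q} {E} ω e ≡ finToFun ω′ e) →
  AtMost (hyperplane q E) P
AtMost-coordinate {E = suc E} {q} e {P} determined =
  (λ ω _ → rest ω) , λ {ω} {ω′} p p′ eq →
    finToFun-injective {q} {suc E} λ i → agree p p′ eq i
  where
  rest : Fin (q ^ suc E) → Fin (q ^ E)
  rest ω = funToFin (Vector.removeAt (finToFun {q} {suc E} ω) e)
  off : ∀ {ω ω′} → rest ω ≡ rest ω′ → ∀ i → i ≢ e →
    finToFun {q} {suc E} ω i ≡ finToFun {q} {suc E} ω′ i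
  off {ω} {ω′} eq i i≢e = subst (λ j → finToFun {q} {suc E} ω j ≡ finToFun {q} {suc E} ω′ j)
    (punchIn-punchOut (i≢e ∘ sym)) (funToFin-injective eq (punchOut (i≢e ∘ sym)))
  agree : ∀ {ω ω′} → P ω → P ω′ → rest ω ≡ rest ω′ →
    ∀ i → finToFun {q} {suc E} ω i ≡ finToFun {q} {suc E} ω′ i
  agree {ω} {ω′} p p′ eq i with i ≟ e
  ... | yes refl = determined p p′ (off eq)
  ... | no i≢e   = off eq i i≢e

argmax : (f : Fin (suc n) → ℕ) → ∃ λ r → ∀ s → f s ≤ f r
argmax {zero}  f = zero , λ { zero → ℕP.≤-refl }
argmax {suc n} f with argmax (f ∘ suc)
... | r , max with ℕP.≤-total (f zero) (f (suc r))
... | inj₁ f0≤ = suc r , λ { zero → f0≤ ; (suc s) → max s }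
... | inj₂ ≤f0 = zero , λ { zero → ℕP.≤-refl ; (suc s) → ℕP.≤-trans (max s) ≤f0 }

sumℕ-drop : (f g : Fin m → ℕ) (r : Fin m) → f r ≡ suc (g r) →
  (∀ s → s ≢ r → f s ≡ g s) → sumℕ f ≡ suc (sumℕ g)
sumℕ-drop f g zero    at off =
  cong₂ ℕ._+_ at (sumℕ-cong λ s → off (suc s) λ ())
sumℕ-drop f g (suc r) at off = trans
  (cong₂ ℕ._+_ (off zero λ ()) (sumℕ-drop (f ∘ suc) (g ∘ suc) r at λ s s≢r →
    off (suc s) λ { refl → s≢r refl }))
  (ℕP.+-suc (g zero) _)

-- Values and heights in a network

module Height {v t n} (G : Network v t n) where

  open Network G

  private
    max : (Fin k → ℕ) → ℕ
    max = Vector.foldr _⊔_ 0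

    max-cong : {f g : Fin k → ℕ} → (∀ i → f i ≡ g i) → max f ≡ max g
    max-cong {zero}  eq = refl
    max-cong {suc k} eq = cong₂ _⊔_ (eq zero) (max-cong (eq ∘ suc))

    ≤-max : (f : Fin k → ℕ) → ∀ i → f i ≤ max f
    ≤-max f zero    = ℕP.m≤m⊔n _ _
    ≤-max f (suc i) = ℕP.≤-trans (≤-max (f ∘ suc) i) (ℕP.m≤n⊔m (f zero) _)

    max-zero : (f : Fin k → ℕ) → (∀ i → f i ≡ 0) → max f ≡ 0
    max-zero {zero}  f eq = refl
    max-zero {suc k} f eq = cong₂ _⊔_ (eq zero) (max-zero (f ∘ suc) (eq ∘ suc))

    below : ∀ {u w} → (u ⟶ w → ℕ) → Dec (u ⟶ w) → ℕ
    below h (yes e) = suc (h e)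
    below h (no _)  = 0

    step : ∀ w → (∀ {u} → u ⟶ w → ℕ) → ℕ
    step w h = max λ u → below h (u ⟶? w)

    step-ext : ∀ w {h h′ : ∀ {u} → u ⟶ w → ℕ} →
      (∀ {u} (e : u ⟶ w) → h e ≡ h′ e) → step w h ≡ step w h′
    step-ext w {h} {h′} eq = max-cong pointwise
      where
      pointwise : ∀ u → below h (u ⟶? w) ≡ below h′ (u ⟶? w)
      pointwise u with u ⟶? w
      ... | yes e = cong suc (eq e)
      ... | no _  = refl

    open All ⟶-wellFounded 0ℓ using (wfRec)

  -- The length of a longest path ending at the vertex. It supplies the topological order in which
  -- the frontier moves.
  height : Fin v → ℕ
  height = wfRec (λ _ → ℕ) step

  private
    height-unfold : ∀ w → height w ≡ step w (λ {u} _ → height u)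
    height-unfold w = FixPoint.unfold-wfRec ⟶-wellFounded (λ _ → ℕ) step step-ext {w}

  ⟶⇒height< : ∀ {u w} → u ⟶ w → height u < height w
  ⟶⇒height< {u} {w} e = subst (height u <_) (sym (height-unfold w))
    (ℕP.≤-trans (own (u ⟶? w)) (≤-max (λ u → below (λ _ → height u) (u ⟶? w)) u))
    where
    own : (d : Dec (u ⟶ w)) → height u < below (λ _ → height u) d
    own (yes _) = ℕP.≤-refl
    own (no ¬e) = contradiction e ¬e

  height-input : ∀ i → height (input i) ≡ 0
  height-input i = trans (height-unfold (input i)) (max-zero _ none)
    where
    none : ∀ u → below (λ _ → height u) (u ⟶? input i) ≡ 0
    none u with u ⟶? input i
    ... | yes e = contradiction e (input-source i)
    ... | no _  = refl

-- Values in the circuit: gate equation, linearity, locality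

module Circuit {c ℓ₁ ℓ₂} (F : FiniteField c ℓ₁ ℓ₂) {v t n : ℕ} (G : Network v t n) where

  open FiniteField F hiding (zero) renaming (refl to ≈-refl; sym to ≈-sym; trans to ≈-trans)
  open Network G
  open SemiringSum (CommutativeRing.semiring commutativeRing)
    using (sum; sum-cong-≋; ∑-distrib-+; *-distribˡ-sum)
  open SetoidReasoning setoid

  Coefficients : Set c
  Coefficients = Edge → Carrier

  -- The decision is an argument, as it is for `contribution` inside `valueAcc`, so that the two
  -- sums can be compared summand by summand.
  term : Coefficients → (Fin v → Carrier) → ∀ {w} e → Dec (tgt e ≡ w) → Carrier
  term κ h e (yes _) = κ e * h (src e)
  term κ h e (no _)  = 0#

  inflow : Coefficients → (Fin v → Carrier) → Fin v → Carrier
  inflow κ h w = sum λ e → term κ h e (tgt e ≟ w)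

  inflow-cong : ∀ {κ κ′ h h′ w} →
    (∀ e → tgt e ≡ w → κ e * h (src e) ≈ κ′ e * h′ (src e)) →
    inflow κ h w ≈ inflow κ′ h′ w
  inflow-cong {κ} {κ′} {h} {h′} {w} eq = sum-cong-≋ pointwise
    where
    pointwise : ∀ e → term κ h e (tgt e ≟ w) ≈ term κ′ h′ e (tgt e ≟ w)
    pointwise e with tgt e ≟ w
    ... | yes p = eq e p
    ... | no _  = ≈-refl

  IsGate : Fin v → Set
  IsGate w = ¬ ∃ λ i → input i ≡ w

  -- The summands of valueAcc come from a local function without a name; the
  -- type of summand is inferred from its use.
  mutual

    valueAcc-irrelevant : ∀ κ x w (a a′ : Acc _⟶_ w) →
      valueAcc F G κ x w a ≈ valueAcc F G κ x w a′
    valueAcc-irrelevant κ x w (acc rs) (acc rs′) with any? (λ i → input i ≟ w)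
    ... | yes _ = ≈-refl
    ... | no ¬i = sum-cong-≋ (summand κ x w rs rs′ ¬i)

    summand : ∀ κ x w (rs rs′ : ∀ {u} → u ⟶ w → Acc _⟶_ u) (¬i : IsGate w) e → _
    summand κ x w rs rs′ ¬i e with tgt e ≟ w
    ... | yes refl = *-cong ≈-refl (valueAcc-irrelevant κ x (src e) (rs _) (rs′ _))
    ... | no _     = ≈-refl

  mutual

    -- Replacing the accessibility proofs met in the recursion by the canonical ones turns the
    -- recursive definition into an equation for `value`.
    valueAcc-gate : ∀ κ x w (a : Acc _⟶_ w) → IsGate w →
      valueAcc F G κ x w a ≈ inflow κ (value F G κ x) w
    valueAcc-gate κ x w (acc rs) gate with any? (λ i → input i ≟ w)
    ... | yes i = contradiction i gate
    ... | no ¬i = sum-cong-≋ (summand′ κ x w rs ¬i)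

    summand′ : ∀ κ x w (rs : ∀ {u} → u ⟶ w → Acc _⟶_ u) (¬i : IsGate w) e → _
    summand′ κ x w rs ¬i e with tgt e ≟ w
    ... | yes refl =
      *-cong ≈-refl (valueAcc-irrelevant κ x (src e) (rs _) (⟶-wellFounded (src e)))
    ... | no _     = ≈-refl

  value-gate : ∀ κ x {w} → IsGate w → value F G κ x w ≈ inflow κ (value F G κ x) w
  value-gate κ x {w} = valueAcc-gate κ x w (⟶-wellFounded w)

  value-input : ∀ κ x i → value F G κ x (input i) ≈ x i
  value-input κ x i = valueAcc-input (⟶-wellFounded (input i))
    where
    valueAcc-input : (a : Acc _⟶_ (input i)) → valueAcc F G κ x (input i) a ≈ x i
    valueAcc-input (acc rs) with any? (λ j → input j ≟ input i)
    ... | yes (j , eq) = reflexive (cong x (input-injective eq))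
    ... | no ¬i        = contradiction (i , refl) ¬i

  -- Well-founded induction along the edges. The gate case speaks of listed edges because `inflow`
  -- is a sum over them.
  vertex-induction : ∀ {ℓ} (P : Fin v → Set ℓ) → (∀ i → P (input i)) →
    (∀ {w} → IsGate w → (∀ e → tgt e ≡ w → P (src e)) → P w) → ∀ w → P w
  vertex-induction P onInput onGate = All.wfRec ⟶-wellFounded _ P step
    where
    step : ∀ w → (∀ {u} → u ⟶ w → P u) → P w
    step w below with any? (λ i → input i ≟ w)
    ... | yes (i , refl) = onInput i
    ... | no gate          = onGate gate λ { e refl → below (src⟶tgt e) }

  -- Every gate is linear in the values of its predecessors, so linearity passes from the inputs to
  -- all vertices.
  value-linear : ∀ κ {x y z} l → (∀ i → z i ≈ x i + l * y i) →
    ∀ w → value F G κ z w ≈ value F G κ x w + l * value F G κ y w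
  value-linear κ {x} {y} {z} l z≈x+ly = vertex-induction _
    (λ i → begin
      value F G κ z (input i)                                   ≈⟨ value-input κ z i ⟩
      z i                                                       ≈⟨ z≈x+ly i ⟩
      x i + l * y i
        ≈⟨ +-cong (value-input κ x i) (*-cong ≈-refl (value-input κ y i)) ⟨
      value F G κ x (input i) + l * value F G κ y (input i)     ∎)
    λ {w} gate below → begin
      value F G κ z w                     ≈⟨ value-gate κ z gate ⟩
      inflow κ (value F G κ z) w          ≈⟨ sum-cong-≋ (pointwise below) ⟩
      sum (λ e → X e w + l * Y e w)       ≈⟨ ∑-distrib-+ (λ e → X e w) (λ e → l * Y e w) ⟩
      sum (λ e → X e w) + sum (λ e → l * Y e w)
        ≈⟨ +-cong ≈-refl (*-distribˡ-sum l (λ e → Y e w)) ⟨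
      inflow κ (value F G κ x) w + l * inflow κ (value F G κ y) w
        ≈⟨ +-cong (value-gate κ x gate) (*-cong ≈-refl (value-gate κ y gate)) ⟨
      value F G κ x w + l * value F G κ y w ∎
    where
    X Y : Edge → Fin v → Carrier
    X e w = term κ (value F G κ x) e (tgt e ≟ w)
    Y e w = term κ (value F G κ y) e (tgt e ≟ w)
    factor : ∀ k a b → k * (a + l * b) ≈ k * a + l * (k * b)
    factor k a b = begin
      k * (a + l * b)         ≈⟨ distribˡ k a (l * b) ⟩
      k * a + k * (l * b)     ≈⟨ +-cong ≈-refl (*-assoc k l b) ⟨
      k * a + (k * l) * b     ≈⟨ +-cong ≈-refl (*-cong (*-comm k l) ≈-refl) ⟩
      k * a + (l * k) * b     ≈⟨ +-cong ≈-refl (*-assoc l k b) ⟩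
      k * a + l * (k * b)     ∎
    pointwise : ∀ {w} → (∀ e → tgt e ≡ w →
      value F G κ z (src e) ≈ value F G κ x (src e) + l * value F G κ y (src e)) →
      ∀ e → term κ (value F G κ z) e (tgt e ≟ w) ≈ X e w + l * Y e w
    pointwise {w} below e with tgt e ≟ w
    ... | yes p = ≈-trans (*-cong ≈-refl (below e p)) (factor (κ e) _ _)
    ... | no _  = ≈-sym (≈-trans (+-cong ≈-refl (zeroʳ l)) (+-identityˡ 0#))

  value-cong : ∀ κ {x y} → (∀ i → x i ≈ y i) → ∀ w → value F G κ x w ≈ value F G κ y w
  value-cong κ x≈y = vertex-induction _
    (λ i → ≈-trans (value-input κ _ i) (≈-trans (x≈y i) (≈-sym (value-input κ _ i))))
    λ gate below → ≈-trans (value-gate κ _ gate)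
      (≈-trans (inflow-cong λ e p → *-cong ≈-refl (below e p)) (≈-sym (value-gate κ _ gate)))

  -- `D` is closed under predecessors, so the recursion for a vertex in `D` meets only coefficients
  -- on which `κ` and `κ′` agree.
  value-local : ∀ {κ κ′} x {ℓ} (D : Fin v → Set ℓ) →
    (∀ e → D (tgt e) → κ e ≈ κ′ e × D (src e)) →
    ∀ w → D w → value F G κ x w ≈ value F G κ′ x w
  value-local {κ} {κ′} x D closed = vertex-induction _
    (λ i _ → ≈-trans (value-input κ x i) (≈-sym (value-input κ′ x i)))
    λ gate below d → ≈-trans (value-gate κ x gate)
      (≈-trans (inflow-cong λ { e refl → let κ≈κ′ , d′ = closed e d in
                                         *-cong κ≈κ′ (below e refl d′) })
             (≈-sym (value-gate κ′ x gate)))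

  private
    sum-swap : ∀ {k} (f g : Fin k → Carrier) i → (∀ j → j ≢ i → f j ≈ g j) →
      sum f + g i ≈ sum g + f i
    sum-swap f g zero    eq = begin
      (f zero + sum (f ∘ suc)) + g zero ≈⟨ +-comm _ _ ⟩
      g zero + (f zero + sum (f ∘ suc))
        ≈⟨ +-cong ≈-refl (≈-trans (+-comm _ _) (+-cong (sum-cong-≋ λ j → eq (suc j) λ ()) ≈-refl)) ⟩
      g zero + (sum (g ∘ suc) + f zero) ≈⟨ +-assoc _ _ _ ⟨
      (g zero + sum (g ∘ suc)) + f zero ∎
    sum-swap f g (suc i) eq = begin
      (f zero + sum (f ∘ suc)) + g (suc i) ≈⟨ +-assoc _ _ _ ⟩
      f zero + (sum (f ∘ suc) + g (suc i))
        ≈⟨ +-cong (eq zero λ ()) (sum-swap (f ∘ suc) (g ∘ suc) i λ j j≢i →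
             eq (suc j) λ { refl → j≢i refl }) ⟩
      g zero + (sum (g ∘ suc) + f (suc i)) ≈⟨ +-assoc _ _ _ ⟨
      (g zero + sum (g ∘ suc)) + f (suc i) ∎

  -- The two inflows at the target of `e` differ in the summand of `e` alone. Each side adds the
  -- other circuit's summand, which avoids subtraction.
  inflow-swap : ∀ {κ κ′ h h′} e → (∀ e′ → e′ ≢ e → κ e′ ≈ κ′ e′) →
    (∀ e′ → tgt e′ ≡ tgt e → h (src e′) ≈ h′ (src e′)) →
    inflow κ h (tgt e) + κ′ e * h′ (src e) ≈ inflow κ′ h′ (tgt e) + κ e * h (src e)
  inflow-swap {κ} {κ′} {h} {h′} e κ≈κ′ h≈h′ = begin
    inflow κ h (tgt e) + κ′ e * h′ (src e)   ≈⟨ +-cong ≈-refl (own κ′ h′) ⟨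
    sum f + g e                              ≈⟨ sum-swap f g e pointwise ⟩
    sum g + f e                              ≈⟨ +-cong ≈-refl (own κ h) ⟩
    inflow κ′ h′ (tgt e) + κ e * h (src e)   ∎
    where
    f g : Edge → Carrier
    f e′ = term κ h e′ (tgt e′ ≟ tgt e)
    g e′ = term κ′ h′ e′ (tgt e′ ≟ tgt e)
    own : ∀ κ h → term κ h e (tgt e ≟ tgt e) ≈ κ e * h (src e)
    own κ h with tgt e ≟ tgt e
    ... | yes _ = ≈-refl
    ... | no ¬p = contradiction refl ¬p
    pointwise : ∀ e′ → e′ ≢ e → f e′ ≈ g e′
    pointwise e′ e′≢e with tgt e′ ≟ tgt e
    ... | yes p = *-cong (κ≈κ′ e′ e′≢e) (h≈h′ e′ p)
    ... | no _  = ≈-refl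

-- Linear maps over a finite field

module FiniteFieldProperties {c ℓ₁ ℓ₂} (F : FiniteField c ℓ₁ ℓ₂) where

  open FiniteField F hiding (zero) renaming (refl to ≈-refl; sym to ≈-sym; trans to ≈-trans)
  open SetoidReasoning setoid

  private
    module enumeration = Inverse enumeration

  index-injective : ∀ {a b} → index a ≡ index b → a ≈ b
  index-injective {a} {b} eq = begin
    a                 ≈⟨ enumeration.strictlyInverseˡ a ⟨
    element (index a) ≡⟨ cong element eq ⟩
    element (index b) ≈⟨ enumeration.strictlyInverseˡ b ⟩
    b                 ∎

  index-cong : ∀ {a b} → a ≈ b → index a ≡ index b
  index-cong = enumeration.from-cong

  element-injective : ∀ {i j} → element i ≈ element j → i ≡ j
  element-injective {i} {j} eq = trans (sym (enumeration.strictlyInverseʳ i))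
    (trans (index-cong eq) (enumeration.strictlyInverseʳ j))

  infix 4 _≈?_

  _≈?_ : ∀ a b → Dec (a ≈ b)
  a ≈? b = map′ index-injective index-cong (index a ≟ index b)

  -- An element that is not 0 is only not not apart from 0, which is enough
  -- because equality is decidable.
  cancel-nonzero : ∀ {a b} → ¬ a ≈ 0# → a * b ≈ 0# → b ≈ 0#
  cancel-nonzero {a} {b} a≉0 ab≈0 = decidable-stable (b ≈? 0#) λ b≉0 →
    a≉0 (proj₁ (tight a 0#) λ a#0 → b≉0 (fromInverse (#⇒invertible a#0)))
    where
    fromInverse : ∃ (λ a⁻¹ → a⁻¹ * (a - 0#) ≈ 1# × (a - 0#) * a⁻¹ ≈ 1#) → b ≈ 0#
    fromInverse (a⁻¹ , a⁻¹a≈1 , _) = begin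
      b                      ≈⟨ *-identityˡ b ⟨
      1# * b                 ≈⟨ *-cong a⁻¹a≈1 ≈-refl ⟨
      (a⁻¹ * (a - 0#)) * b
        ≈⟨ *-cong (*-cong ≈-refl
             (≈-trans (+-cong ≈-refl (RingProperties.-0#≈0# ring)) (+-identityʳ a))) ≈-refl ⟩
      (a⁻¹ * a) * b          ≈⟨ *-assoc a⁻¹ a b ⟩
      a⁻¹ * (a * b)          ≈⟨ *-cong ≈-refl ab≈0 ⟩
      a⁻¹ * 0#               ≈⟨ zeroʳ a⁻¹ ⟩
      0#                     ∎
      where ring = CommutativeRing.ring commutativeRing

  minus-one : ∀ a b → a + - 1# * b ≈ a - b
  minus-one a b = +-cong ≈-refl (RingProperties.-1*x≈-x (CommutativeRing.ring commutativeRing) b)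

  difference≈0 : ∀ {a b} → a - b ≈ 0# → a ≈ b
  difference≈0 {a} {b} = RingProperties.x∙y⁻¹≈ε⇒x≈y (CommutativeRing.ring commutativeRing) a b

  -- Vectors are numbered just as the samples for coefficients and inputs are, so counting on `Fin`
  -- applies to all of them.
  point : Fin (order ^ m) → Fin m → Carrier
  point k i = element (finToFun k i)

  code : (Fin m → Carrier) → Fin (order ^ m)
  code x = funToFin (index ∘ x)

  point-code : ∀ (x : Fin m → Carrier) i → point (code x) i ≈ x i
  point-code x i = index-injective (trans (enumeration.strictlyInverseʳ _)
    (finToFun-funToFin (index ∘ x) i))

  code-injective : {x y : Fin m → Carrier} → code x ≡ code y → ∀ i → x i ≈ y i
  code-injective eq i = index-injective (funToFin-injective eq i)

  point-injective : {ω ω′ : Fin (order ^ m)} → (∀ i → point ω i ≈ point ω′ i) → ω ≡ ω′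
  point-injective {m} eq = finToFun-injective {order} {m} λ i → element-injective (eq i)

  -- One law for addition and scaling. As `z` is given only up to pointwise equality, the case
  -- `l = 0` yields that `L` respects this equality.
  IsLinear : ((Fin m → Carrier) → Fin k → Carrier) → Set _
  IsLinear L = ∀ {x y z} l → (∀ i → z i ≈ x i + l * y i) → ∀ r → L z r ≈ L x r + l * L y r

  TrivialKernel : ((Fin m → Carrier) → Fin k → Carrier) → Set _
  TrivialKernel L = ∀ y → (∀ r → L y r ≈ 0#) → ∀ i → y i ≈ 0#

  module _ {L : (Fin m → Carrier) → Fin k → Carrier} (linear : IsLinear L) where

    linear-cong : ∀ {x y} → (∀ i → x i ≈ y i) → ∀ r → L x r ≈ L y r
    linear-cong {x} {y} x≈y r = begin
      L x r              ≈⟨ linear 0# (λ i → ≈-trans (x≈y i) (plus0 (y i) (y i))) r ⟩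
      L y r + 0# * L y r ≈⟨ plus0 (L y r) (L y r) ⟨
      L y r              ∎
      where
      plus0 : ∀ a b → a ≈ a + 0# * b
      plus0 a b = ≈-sym (≈-trans (+-cong ≈-refl (zeroˡ b)) (+-identityʳ a))

    linear-- : ∀ x y r → L (λ i → x i - y i) r ≈ L x r - L y r
    linear-- x y r = ≈-trans (linear (- 1#) (λ i → ≈-sym (minus-one (x i) (y i))) r)
                           (minus-one (L x r) (L y r))

    linear-scale : ∀ l y r → L (λ i → l * y i) r ≈ l * L y r
    linear-scale l y r = begin
      -- The zero vector enters as `y - y`, whose image vanishes by `linear--`.
      L (λ i → l * y i) r                      ≈⟨ linear l expand r ⟩
      L (λ i → y i - y i) r + l * L y r        ≈⟨ +-cong (linear-- y y r) ≈-refl ⟩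
      (L y r - L y r) + l * L y r              ≈⟨ +-cong (-‿inverseʳ (L y r)) ≈-refl ⟩
      0# + l * L y r                           ≈⟨ +-identityˡ _ ⟩
      l * L y r                                ∎
      where
      expand : ∀ i → l * y i ≈ (y i - y i) + l * y i
      expand i = ≈-sym (≈-trans (+-cong (-‿inverseʳ (y i)) ≈-refl) (+-identityˡ _))

    -- A finite search through the coded vectors. It makes goodness of a coefficient vector
    -- decidable, both for case distinctions and for the event whose probability is bounded.
    TrivialKernel? : Dec (TrivialKernel L)
    TrivialKernel? = map′
      (λ trivial y Ly≈0 i → ≈-trans (≈-sym (point-code y i))
        (trivial (code y) (λ r → ≈-trans (linear-cong (point-code y) r) (Ly≈0 r)) i))
      (λ trivial ω → trivial (point ω))
      (all? λ ω → all? (λ r → L (point ω) r ≈? 0#) →-dec all? (λ i → point ω i ≈? 0#))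

    kernel⇒injective : TrivialKernel L → ∀ {x y} → (∀ r → L x r ≈ L y r) → ∀ i → x i ≈ y i
    kernel⇒injective trivial {x} {y} Lx≈Ly i = difference≈0 (trivial (λ i → x i - y i)
      (λ r → ≈-trans (linear-- x y r)
        (≈-trans (+-cong (Lx≈Ly r) ≈-refl) (-‿inverseʳ (L y r)))) i)

  -- A trivial kernel makes the map injective on a finite set of codes, and pigeonhole makes it
  -- surjective, without bases or determinants.
  kernel⇒surjective : {L : (Fin m → Carrier) → Fin m → Carrier} → IsLinear L →
    TrivialKernel L → ∀ z → ∃ λ x → ∀ r → L x r ≈ z r
  kernel⇒surjective {L = L} linear trivial z
    with injective⇒surjective (λ ω → code (L (point ω)))
           (λ eq → point-injective (kernel⇒injective linear trivial (code-injective eq)))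
           (code z)
  ... | ω , eq = point ω , code-injective eq

-- Disjoint walks and the random coefficients

module Routings {v t n} (G : Network v t n) where

  open Network G
  open Height G

  infixl 5 _▻_
  infix 4 _∈ʷ_

  -- Built by adding edges at the far end, unlike `Path`, because the induction takes off the last
  -- edge.
  data Walk (a : Fin v) : Fin v → Set where
    []  : Walk a a
    _▻_ : ∀ {u w} → Walk a u → u ⟶ w → Walk a w

  walkLength : ∀ {a w} → Walk a w → ℕ
  walkLength []      = 0
  walkLength (p ▻ _) = suc (walkLength p)

  _∈ʷ_ : ∀ {a w} → Fin v → Walk a w → Set
  _∈ʷ_ {a} x []          = x ≡ a
  _∈ʷ_ {w = w} x (p ▻ _) = x ∈ʷ p ⊎ x ≡ w

  end∈ : ∀ {a w} (p : Walk a w) → w ∈ʷ p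
  end∈ []      = refl
  end∈ (p ▻ _) = inj₂ refl

  trivial-walk : ∀ {a w} (p : Walk a w) → walkLength p ≡ 0 → w ≡ a
  trivial-walk [] _ = refl

  -- A frontier `end` together with the disjoint walks that lead to it. The map `σ` names the inputs
  -- at which the walks start.
  record Routing (σ : Fin m → Fin t) : Set where
    field
      end      : Fin m → Fin v
      walk     : ∀ r → Walk (input (σ r)) (end r)
      disjoint : ∀ {r r′ x} → x ∈ʷ walk r → x ∈ʷ walk r′ → r ≡ r′

    totalLength : ℕ
    totalLength = sumℕ (walkLength ∘ walk)

  open Routing

  -- The walk to be cut back. No other frontier vertex and no predecessor of its end lies downstream
  -- of that end, so the coefficient of `last` does not influence them.
  record Topmost {σ : Fin m → Fin t} (R : Routing σ) : Set where
    field
      row     : Fin m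
      highest : ∀ r → height (end R r) ≤ height (end R row)
      {pred}  : Fin v
      init    : Walk (input (σ row)) pred
      last    : pred ⟶ end R row
      split   : walk R row ≡ init ▻ last

  unsnoc : ∀ {a w} (p : Walk a w) → walkLength p ≡ 0 ⊎
    ∃ λ u → ∃ λ (q : Walk a u) → ∃ λ (e : u ⟶ w) → p ≡ q ▻ e
  unsnoc []      = inj₁ refl
  unsnoc (q ▻ e) = inj₂ (_ , q , e , refl)

  height0⇒trivial : ∀ {i w} (p : Walk (input i) w) → height w ≤ 0 → walkLength p ≡ 0
  height0⇒trivial []      _   = refl
  height0⇒trivial (p ▻ e) h≤0 = contradiction (ℕP.<-≤-trans (⟶⇒height< e) h≤0) ℕP.n≮0

  -- If the walk with the highest end is empty, that end is an input of height 0. Then all ends have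
  -- height 0, and all walks are empty.
  topmost : {σ : Fin m → Fin t} (R : Routing σ) →
    (∀ r → walkLength (walk R r) ≡ 0) ⊎ Topmost R
  topmost {zero}  R = inj₁ λ ()
  topmost {suc m} {σ} R with argmax (height ∘ end R)
  ... | row , highest with unsnoc (walk R row)
  ... | inj₁ len = inj₁ λ r → height0⇒trivial (walk R r) (ℕP.≤-trans (highest r) (ℕP.≤-reflexive
    (trans (cong height (trivial-walk (walk R row) len)) (height-input (σ row)))))
  ... | inj₂ (pred , init , last , split) = inj₂ record
    { row = row ; highest = highest ; init = init ; last = last ; split = split }

  module Shorten {σ : Fin m → Fin t} (R : Routing σ) (T : Topmost R) where

    open Topmost T

    private
      piece : ∀ r → Dec (r ≡ row) → ∃ (Walk (input (σ r)))
      piece r (yes refl) = pred , init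
      piece r (no _)     = end R r , walk R r

      piece⊆walk : ∀ {r x} (d : Dec (r ≡ row)) → x ∈ʷ proj₂ (piece r d) → x ∈ʷ walk R r
      piece⊆walk {x = x} (yes refl) x∈ = subst (x ∈ʷ_) (sym split) (inj₁ x∈)
      piece⊆walk (no _)             x∈ = x∈

    shortened : Routing σ
    shortened = record
      { end      = λ r → proj₁ (piece r (r ≟ row))
      ; walk     = λ r → proj₂ (piece r (r ≟ row))
      ; disjoint = λ {r} {r′} x∈ x∈′ →
                     disjoint R (piece⊆walk (r ≟ row) x∈) (piece⊆walk (r′ ≟ row) x∈′)
      }

    end-row : end shortened row ≡ pred
    end-row with row ≟ row
    ... | yes refl = refl
    ... | no ¬refl = contradiction refl ¬refl

    end-other : ∀ {r} → r ≢ row → end shortened r ≡ end R r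
    end-other {r} r≢row with r ≟ row
    ... | yes r≡row = contradiction r≡row r≢row
    ... | no _      = refl

    totalLength-shortened : totalLength R ≡ suc (totalLength shortened)
    totalLength-shortened = sumℕ-drop _ _ row at off
      where
      at : walkLength (walk R row) ≡ suc (walkLength (walk shortened row))
      at with row ≟ row
      ... | yes refl = cong walkLength split
      ... | no ¬refl = contradiction refl ¬refl
      off : ∀ s → s ≢ row → walkLength (walk R s) ≡ walkLength (walk shortened s)
      off s s≢row with s ≟ row
      ... | yes s≡row = contradiction s≡row s≢row
      ... | no _      = refl

    end≢row : ∀ {r} → r ≢ row → end R r ≢ end R row
    end≢row {r} r≢row eq = r≢row (disjoint R (end∈ (walk R r))
      (subst (_∈ʷ walk R row) (sym eq) (end∈ (walk R row))))

  edge : ∀ {u w} → u ⟶ w → ∃ λ e → src e ≡ u × tgt e ≡ w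
  edge {u} {w} u⟶w = Any.index uw∈edges ,
    cong proj₁ (sym (lookup-index uw∈edges)) , cong proj₂ (sym (lookup-index uw∈edges))
    where
    uw∈edges : (u , w) ∈ₗ edges
    uw∈edges = ∈-filter⁺ (λ e → proj₁ e ⟶? proj₂ e)
      (∈-cartesianProduct⁺ (∈-allFin u) (∈-allFin w)) u⟶w

-- Bad coefficient vectors for one routing

module RandomCoefficients {c ℓ₁ ℓ₂} (F : FiniteField c ℓ₁ ℓ₂) {v t n} (G : Network v t n) where

  open FiniteField F hiding (zero) renaming (refl to ≈-refl; sym to ≈-sym; trans to ≈-trans)
  open FiniteFieldProperties F
  open Network G
  open Circuit F G
  open Height G
  open Routings G
  open Routing
  open SetoidReasoning setoid

  module _ (σ : Fin m → Fin t) where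

    private
      pick : (Fin m → Carrier) → ∀ {i} → Dec (∃ λ r → σ r ≡ i) → Carrier
      pick y (yes (r , _)) = y r
      pick y (no _)        = 0#

    -- Inputs without a walk are set to 0. Such vectors arise as differences of input vectors that
    -- agree at those inputs.
    embed : (Fin m → Carrier) → Fin t → Carrier
    embed y i = pick y (any? λ r → σ r ≟ i)

    embed-linear : IsLinear embed
    embed-linear {x} {y} {z} l z≈x+ly i with any? (λ r → σ r ≟ i)
    ... | yes (r , _) = z≈x+ly r
    ... | no _        = ≈-sym (≈-trans (+-cong ≈-refl (zeroʳ l)) (+-identityˡ 0#))

    embed-σ : Injective _≡_ _≡_ σ → ∀ y r → embed y (σ r) ≡ y r
    embed-σ σ-injective y r with any? (λ s → σ s ≟ σ r)
    ... | yes (s , eq) = cong y (σ-injective eq)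
    ... | no none      = contradiction (r , refl) none

    embed-restrict : ∀ {x} → (∀ i → (∀ r → σ r ≢ i) → x i ≈ 0#) → ∀ i → x i ≈ embed (x ∘ σ) i
    embed-restrict {x} vanishes i with any? (λ r → σ r ≟ i)
    ... | yes (r , eq) = reflexive (cong x (sym eq))
    ... | no none      = vanishes i λ r eq → none (r , eq)

  -- The linear map from the inputs at the starts to the values on the frontier. That the frontier
  -- determines these inputs means that its kernel is trivial.
  transfer : Coefficients → {σ : Fin m → Fin t} → Routing σ → (Fin m → Carrier) → Fin m → Carrier
  transfer κ {σ} R y r = value F G κ (embed σ y) (end R r)

  transfer-linear : ∀ κ {σ : Fin m → Fin t} (R : Routing σ) → IsLinear (transfer κ R)
  transfer-linear κ {σ} R l z≈x+ly r =
    value-linear κ l (embed-linear σ l z≈x+ly) (end R r)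

  Good : {σ : Fin m → Fin t} → Routing σ → Fin (order ^ ∣E∣) → Set _
  Good R ω = TrivialKernel (transfer (coefficients F G ω) R)

  Good? : {σ : Fin m → Fin t} (R : Routing σ) → ∀ ω → Dec (Good R ω)
  Good? R ω = TrivialKernel? (transfer-linear (coefficients F G ω) R)

  module _ {σ : Fin m → Fin t} (R : Routing σ) (T : Topmost R) where

    open Topmost T
    open Shorten R T

    private
      δ : ∀ {r} → Dec (r ≡ row) → Carrier
      δ (yes _) = 1#
      δ (no _)  = 0#

      -- The unit vector at `row`, the prescribed values of x₀ on the shortened frontier.
      dual : Fin m → Carrier
      dual r = δ (r ≟ row)

      dual-row : dual row ≈ 1#
      dual-row with row ≟ row
      ... | yes _    = ≈-refl
      ... | no ¬refl = contradiction refl ¬refl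

    transfer-row : ∀ κ y → transfer κ shortened y row ≈ value F G κ (embed σ y) pred
    transfer-row κ y = reflexive (cong (value F G κ (embed σ y)) end-row)

    transfer-other : ∀ κ y {r} → r ≢ row → transfer κ shortened y r ≈ transfer κ R y r
    transfer-other κ y r≢row = reflexive (cong (value F G κ (embed σ y)) (end-other r≢row))

    -- If the value at the end of the row were nonzero at x₀, the only kernel
    -- candidates, the multiples of x₀, would be excluded.
    value-at-dual : ∀ {κ} x₀ → TrivialKernel (transfer κ shortened) →
      ¬ TrivialKernel (transfer κ R) → (∀ r → transfer κ shortened x₀ r ≈ dual r) →
      transfer κ R x₀ row ≈ 0#
    value-at-dual {κ} x₀ good′ bad dual-x₀ = decidable-stable (_ ≈? 0#) λ nonzero →
      bad λ y Ry≈0 i →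
        let
          l = transfer κ shortened y row

          multiple : ∀ {r} (d : Dec (r ≡ row)) → transfer κ shortened y r ≈ l * δ d
          multiple = λ where
            (yes refl) → ≈-sym (*-identityʳ l)
            (no r≢row)   → ≈-trans (transfer-other κ y r≢row) (≈-trans (Ry≈0 _) (≈-sym (zeroʳ l)))

          agree : ∀ r → transfer κ shortened y r ≈ transfer κ shortened (λ i → l * x₀ i) r
          agree r = ≈-trans (multiple (r ≟ row)) (≈-trans (*-cong ≈-refl (≈-sym (dual-x₀ r)))
            (≈-sym (linear-scale (transfer-linear κ shortened) l x₀ r)))

          y≈lx₀ : ∀ i → y i ≈ l * x₀ i
          y≈lx₀ = kernel⇒injective (transfer-linear κ shortened) good′ agree

          l≈0 : l ≈ 0#
          l≈0 = cancel-nonzero nonzero (begin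
            transfer κ R x₀ row * l           ≈⟨ *-comm _ l ⟩
            l * transfer κ R x₀ row           ≈⟨ linear-scale (transfer-linear κ R) l x₀ row ⟨
            transfer κ R (λ i → l * x₀ i) row ≈⟨ linear-cong (transfer-linear κ R) y≈lx₀ row ⟨
            transfer κ R y row                ≈⟨ Ry≈0 row ⟩
            0#                                ∎)
        in ≈-trans (y≈lx₀ i) (≈-trans (*-cong l≈0 ≈-refl) (zeroˡ (x₀ i)))

    private
      gate : IsGate (end R row)
      gate (i , eq) = input-source i (subst (pred ⟶_) (sym eq) last)

      -- The vertices whose values do not depend on the coefficient of the last edge.
      Upstream : Fin v → Set
      Upstream w = height w ≤ height (end R row) × w ≢ end R row

      upstream-pred : ∀ {u} → u ⟶ end R row → Upstream u
      upstream-pred u⟶ = ℕP.<⇒≤ (⟶⇒height< u⟶) ,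
        λ { refl → ℕP.<-irrefl refl (⟶⇒height< u⟶) }

      upstream-end : ∀ r → Upstream (end shortened r)
      upstream-end r with r ≟ row
      ... | yes refl = upstream-pred last
      ... | no r≢row   = highest r , end≢row r≢row

    module _ {κ κ′ : Coefficients} {e : Edge} (src≡ : src e ≡ pred) (tgt≡ : tgt e ≡ end R row)
             (off : ∀ e′ → e′ ≢ e → κ e′ ≈ κ′ e′) where

      private
        upstream-value : ∀ x {w} → Upstream w → value F G κ x w ≈ value F G κ′ x w
        upstream-value x = value-local x Upstream closed _
          where
          closed : ∀ e′ → Upstream (tgt e′) → κ e′ ≈ κ′ e′ × Upstream (src e′)
          closed e′ (h≤ , ≢row) = off e′ (λ { refl → ≢row tgt≡ }) ,
            ℕP.<⇒≤ src< , λ eq → ℕP.<-irrefl (cong height eq) src<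
            where
            src< : height (src e′) < height (end R row)
            src< = ℕP.<-≤-trans (⟶⇒height< (src⟶tgt e′)) h≤

      -- The x₀ found for `κ` also serves `κ′`, since upstream values coincide. By badness both
      -- circuits have value 0 at the end of the row. There `e` contributes its coefficient times 1
      -- and all other contributions agree, so the two coefficients of `e` are equal.
      last-coefficient-determined :
        TrivialKernel (transfer κ shortened) → ¬ TrivialKernel (transfer κ R) →
        TrivialKernel (transfer κ′ shortened) → ¬ TrivialKernel (transfer κ′ R) →
        κ e ≈ κ′ e
      last-coefficient-determined good bad good′ bad′ = begin
        κ e                              ≈⟨ *-identityʳ (κ e) ⟨
        κ e * 1#                         ≈⟨ *-cong ≈-refl (at-src κ dual-x₀) ⟨
        κ e * V (src e)                  ≈⟨ +-identityˡ _ ⟨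
        0# + κ e * V (src e)
          ≈⟨ +-cong (at-tgt κ′ (value-at-dual x₀ good′ bad′ dual-x₀′)) ≈-refl ⟨
        inflow κ′ V′ (tgt e) + κ e * V (src e)
          ≈⟨ inflow-swap e off (λ e′ p → upstream-value X
               (upstream-pred (subst (src e′ ⟶_) (trans p tgt≡) (src⟶tgt e′)))) ⟨
        inflow κ V (tgt e) + κ′ e * V′ (src e)
          ≈⟨ +-cong (at-tgt κ (value-at-dual x₀ good bad dual-x₀)) ≈-refl ⟩
        0# + κ′ e * V′ (src e)           ≈⟨ +-identityˡ _ ⟩
        κ′ e * V′ (src e)                ≈⟨ *-cong ≈-refl (at-src κ′ dual-x₀′) ⟩
        κ′ e * 1#                        ≈⟨ *-identityʳ (κ′ e) ⟩
        κ′ e                             ∎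
        where
        solution : ∃ λ x → ∀ r → transfer κ shortened x r ≈ dual r
        solution = kernel⇒surjective (transfer-linear κ shortened) good dual
        x₀ : Fin m → Carrier
        x₀ = proj₁ solution
        dual-x₀ : ∀ r → transfer κ shortened x₀ r ≈ dual r
        dual-x₀ = proj₂ solution
        X : Fin t → Carrier
        X = embed σ x₀
        V V′ : Fin v → Carrier
        V  = value F G κ X
        V′ = value F G κ′ X
        dual-x₀′ : ∀ r → transfer κ′ shortened x₀ r ≈ dual r
        dual-x₀′ r = ≈-trans (≈-sym (upstream-value X (upstream-end r))) (dual-x₀ r)
        at-src : ∀ κ → (∀ r → transfer κ shortened x₀ r ≈ dual r) → value F G κ X (src e) ≈ 1#
        at-src κ dual-x₀ = begin
          value F G κ X (src e)     ≡⟨ cong (value F G κ X) src≡ ⟩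
          value F G κ X pred        ≈⟨ transfer-row κ x₀ ⟨
          transfer κ shortened x₀ row ≈⟨ dual-x₀ row ⟩
          dual row                  ≈⟨ dual-row ⟩
          1#                        ∎
        at-tgt : ∀ κ → value F G κ X (end R row) ≈ 0# → inflow κ (value F G κ X) (tgt e) ≈ 0#
        at-tgt κ eq = ≈-trans (reflexive (cong (inflow κ (value F G κ X)) tgt≡))
          (≈-trans (≈-sym (value-gate κ X gate)) eq)

  -- Induction on the total length. Either the shortened routing is already bad, or badness appears
  -- with the last edge of the topmost walk. In the second case the other coefficients determine
  -- that of the edge, which costs one hyperplane-sized set.
  bad-at-most : {σ : Fin m → Fin t} → Injective _≡_ _≡_ σ → (R : Routing σ) →
    ∀ ℓ → totalLength R ≡ ℓ → AtMost (ℓ ℕ.* hyperplane order ∣E∣) (λ ω → ¬ Good R ω)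
  bad-at-most {σ = σ} σ-inj R ℓ len with topmost R
  bad-at-most {m} {σ} σ-inj R ℓ len | inj₁ flat = atMost ℓ len
    where
    total≡0 : totalLength R ≡ 0
    total≡0 = trans (sumℕ-cong flat) (sumℕ-zero m)
    atMost : ∀ ℓ → totalLength R ≡ ℓ → AtMost (ℓ ℕ.* hyperplane order ∣E∣) (λ ω → ¬ Good R ω)
    atMost (suc ℓ) len = contradiction (trans (sym total≡0) len) λ ()
    -- With empty walks the frontier consists of the starting inputs, and `transfer` is the
    -- identity.
    atMost zero    len = AtMost-empty λ ω bad → bad λ y Ry≈0 r →
      let κ = coefficients F G ω in begin
      y r                                       ≡⟨ embed-σ σ σ-inj y r ⟨
      embed σ y (σ r)                           ≈⟨ value-input κ (embed σ y) (σ r) ⟨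
      value F G κ (embed σ y) (input (σ r))
        ≡⟨ cong (value F G κ (embed σ y)) (trivial-walk (walk R r) (flat r)) ⟨
      transfer κ R y r                          ≈⟨ Ry≈0 r ⟩
      0#                                        ∎
  bad-at-most σ-inj R zero    len | inj₂ T =
    contradiction (trans (sym len) (Shorten.totalLength-shortened R T)) λ ()
  bad-at-most σ-inj R (suc ℓ) len | inj₂ T = AtMost-⊆ split?
    (AtMost-∪
      (AtMost-coordinate {q = order} e λ { {ω} {ω′} (good , bad) (good′ , bad′) off →
        element-injective (last-coefficient-determined R T src≡ tgt≡
          (λ e′ e′≢e → reflexive (cong element (off e′ e′≢e))) good bad good′ bad′) })
      (bad-at-most σ-inj shortened ℓ (ℕP.suc-injective (trans (sym totalLength-shortened) len))))
    where
    open Topmost T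
    open Shorten R T
    e : Edge
    e = proj₁ (edge last)
    src≡ : src e ≡ pred
    src≡ = proj₁ (proj₂ (edge last))
    tgt≡ : tgt e ≡ end R row
    tgt≡ = proj₂ (proj₂ (edge last))
    split? : ∀ ω → ¬ Good R ω → (Good shortened ω × ¬ Good R ω) ⊎ ¬ Good shortened ω
    split? ω bad with Good? shortened ω
    ... | yes good = inj₁ (good , bad)
    ... | no bad′  = inj₂ bad′

-- Entropy

sumℕ-const : ∀ m c → sumℕ {m} (λ _ → c) ≡ m ℕ.* c
sumℕ-const zero    c = refl
sumℕ-const (suc m) c = cong (c ℕ.+_) (sumℕ-const m c)

indicator : ∀ {p} {P : Set p} → Dec P → ℕ
indicator (yes _) = 1
indicator (no _)  = 0

count-∷ : ∀ {a p} {A : Set a} {P : A → Set p} (P? : Decidable P) x (xs : Vec A n) →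
  count P? (x ∷ xs) ≡ indicator (P? x) ℕ.+ count P? xs
count-∷ P? x xs with P? x
... | yes _ = refl
... | no _  = refl

count-cong : ∀ {a p q} {A : Set a} {P : A → Set p} {Q : A → Set q}
  (P? : Decidable P) (Q? : Decidable Q) →
  (∀ {x} → P x → Q x) → (∀ {x} → Q x → P x) → (xs : Vec A n) → count P? xs ≡ count Q? xs
count-cong P? Q? P⇒Q Q⇒P []       = refl
count-cong P? Q? P⇒Q Q⇒P (x ∷ xs) with P? x | Q? x
... | yes _ | yes _ = cong suc (count-cong P? Q? P⇒Q Q⇒P xs)
... | no _  | no _  = count-cong P? Q? P⇒Q Q⇒P xs
... | yes p | no ¬q = contradiction (P⇒Q p) ¬q
... | no ¬p | yes q = contradiction (Q⇒P q) ¬p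

count-none : ∀ {a p} {A : Set a} {P : A → Set p} (P? : Decidable P) (f : Fin n → A) →
  (∀ i → ¬ P (f i)) → count P? (tabulate f) ≡ 0
count-none {n = zero}  P? f ¬P = refl
count-none {n = suc n} P? f ¬P with P? (f zero)
... | yes p = contradiction p (¬P zero)
... | no _  = count-none P? (f ∘ suc) (¬P ∘ suc)

count-unique : ∀ {a p} {A : Set a} {P : A → Set p} (P? : Decidable P) (f : Fin n → A) i →
  P (f i) → (∀ j → P (f j) → j ≡ i) → count P? (tabulate f) ≡ 1
count-unique P? f zero    Pfi unique with P? (f zero)
... | yes _ = cong suc (count-none P? (f ∘ suc) λ j p → contradiction (unique (suc j) p) λ ())
... | no ¬p = contradiction Pfi ¬p
count-unique P? f (suc i) Pfi unique with P? (f zero)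
... | yes p = contradiction (unique zero p) λ ()
... | no _  = count-unique P? (f ∘ suc) i Pfi (λ j → suc-injective ∘ unique (suc j))

sumℕ-indicator : ∀ {p} {P : Set p} (P? : Dec P) (y₀ : Fin l) →
  sumℕ (λ y → indicator (P? ×-dec (y₀ ≟ y))) ≡ indicator P?
sumℕ-indicator {l} (no _) y₀ = sumℕ-zero l
sumℕ-indicator (yes p) y₀ = one y₀
  where
  one : ∀ {l} (y₀ : Fin l) → sumℕ (λ y → indicator (yes p ×-dec (y₀ ≟ y))) ≡ 1
  one {suc l} zero     = cong suc (sumℕ-zero l)
  one {suc l} (suc y₀) = trans (sumℕ-cong shift) (one y₀)
    where
    shift : ∀ y → indicator (yes p ×-dec (suc y₀ ≟ suc y)) ≡ indicator (yes p ×-dec (y₀ ≟ y))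
    shift y with y₀ ≟ y
    ... | yes _ = refl
    ... | no _  = refl

-- Double counting: every sample has exactly one value under `Y`.
count-marginal : ∀ {a p} {A : Set a} {P : A → Set p} (P? : Decidable P) (Y : A → Fin l)
  (xs : Vec A n) → count P? xs ≡ sumℕ (λ y → count (λ x → P? x ×-dec (Y x ≟ y)) xs)
count-marginal {l} P? Y []       = sym (sumℕ-zero l)
count-marginal {l} P? Y (x ∷ xs) = begin
  count P? (x ∷ xs)                      ≡⟨ count-∷ P? x xs ⟩
  indicator (P? x) ℕ.+ count P? xs
    ≡⟨ cong₂ ℕ._+_ (sym (sumℕ-indicator (P? x) (Y x))) (count-marginal P? Y xs) ⟩
  sumℕ (λ y → indicator (P? x ×-dec (Y x ≟ y))) ℕ.+ sumℕ (λ y → count (Q? y) xs)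
    ≡⟨ sumℕ-+ (λ y → indicator (P? x ×-dec (Y x ≟ y))) (λ y → count (Q? y) xs) ⟨
  sumℕ (λ y → indicator (P? x ×-dec (Y x ≟ y)) ℕ.+ count (Q? y) xs)
    ≡⟨ sumℕ-cong (λ y → sym (count-∷ (Q? y) x xs)) ⟩
  sumℕ (λ y → count (Q? y) (x ∷ xs))     ∎
  where
  open ≡-Reasoning
  Q? : ∀ y → Decidable _
  Q? y x = P? x ×-dec (Y x ≟ y)

module _ (X : Fin N → Fin k) (Y : Fin N → Fin l) where

  #₂-sumʳ : ∀ x → # X x ≡ sumℕ (#₂ X Y x)
  #₂-sumʳ x = count-marginal (λ ω → X ω ≟ x) Y (Vec.allFin N)

  #₂-sumˡ : ∀ y → # Y y ≡ sumℕ (λ x → #₂ X Y x y)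
  #₂-sumˡ y = trans (count-marginal (λ ω → Y ω ≟ y) X (Vec.allFin N))
    (sumℕ-cong λ x → count-cong (λ ω → (Y ω ≟ y) ×-dec (X ω ≟ x))
      (λ ω → (X ω ≟ x) ×-dec (Y ω ≟ y)) swap swap (Vec.allFin N))

-- Quotients of counts and entropies as sequences

÷-cross : ∀ {a b c d} → a ℕ.* suc d ≡ c ℕ.* suc b → a ÷ suc b ≡ c ÷ suc d
÷-cross {a} {b} {c} {d} eq = ℚP.fromℚᵘ-cong {ℚᵘ.mkℚᵘ (ℤ.+ a) b} {ℚᵘ.mkℚᵘ (ℤ.+ c) d}
  (ℚᵘ.*≡* (trans (sym (ℤP.pos-* a (suc d))) (trans (cong ℤ.+_ eq) (ℤP.pos-* c (suc b)))))

÷-+ : ∀ a b n → a ÷ n ℚ.+ b ÷ n ≡ (a ℕ.+ b) ÷ n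
÷-+ a b zero    = refl
÷-+ a b (suc n) = ℚP.toℚᵘ-injective (begin
  ℚ.toℚᵘ (a ÷ suc n ℚ.+ b ÷ suc n)             ≈⟨ ℚP.toℚᵘ-homo-+ (a ÷ suc n) (b ÷ suc n) ⟩
  ℚ.toℚᵘ (a ÷ suc n) ℚᵘ.+ ℚ.toℚᵘ (b ÷ suc n)
    ≈⟨ ℚᵘP.+-cong (ℚP.toℚᵘ-fromℚᵘ (frac a)) (ℚP.toℚᵘ-fromℚᵘ (frac b)) ⟩
  frac a ℚᵘ.+ frac b
    ≈⟨ ℚᵘ.*≡* (trans (identity (ℤ.+ a) (ℤ.+ b) (ℤ.+ suc n))
         (cong (λ z → z ℤ.* (ℤ.+ suc n ℤ.* ℤ.+ suc n)) (sym (ℤP.pos-+ a b)))) ⟩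
  frac (a ℕ.+ b)                                 ≈⟨ ℚP.toℚᵘ-fromℚᵘ (frac (a ℕ.+ b)) ⟨
  ℚ.toℚᵘ ((a ℕ.+ b) ÷ suc n)                     ∎)
  where
  open ℚᵘP.≃-Reasoning
  open ℤSolver.+-*-Solver
  frac : ℕ → ℚᵘ.ℚᵘ
  frac a = ℚᵘ.mkℚᵘ (ℤ.+ a) n
  identity : ∀ a b n → (a ℤ.* n ℤ.+ b ℤ.* n) ℤ.* n ≡ (a ℤ.+ b) ℤ.* (n ℤ.* n)
  identity = solve 3 (λ a b n → (a :* n :+ b :* n) :* n := (a :+ b) :* (n :* n)) refl

0÷n≡0 : ∀ n → 0 ÷ n ≡ 0ℚ
0÷n≡0 zero    = refl
0÷n≡0 (suc n) = ÷-cross {0} {n} {0} {0} refl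

n÷n≡1 : ∀ n → suc n ÷ suc n ≡ 1ℚ
n÷n≡1 n = ÷-cross {suc n} {n} {1} {0} (ℕP.*-comm (suc n) 1)

self-÷ : 0 < n → n ÷ n ≡ 1ℚ
self-÷ {suc n} _ = n÷n≡1 n

÷-sum : (a : Fin k → ℕ) → ∀ n → sumℚ (λ i → a i ÷ n) ≡ sumℕ a ÷ n
÷-sum {zero}  a n = sym (0÷n≡0 n)
÷-sum {suc k} a n = trans (cong (a zero ÷ n ℚ.+_) (÷-sum (a ∘ suc) n)) (÷-+ (a zero) _ n)

-- The entropy identities below hold for each term of the approximating sequences, so they call for
-- no estimate of limits.
seq≡⇒≃ : ∀ {x y} → (∀ i → seq x i ≡ seq y i) → x Real.≃ y
seq≡⇒≃ {x} {y} eq δ 0<δ = 0 , λ {i} _ → ℚP.≤-trans (ℚP.≤-reflexive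
  (trans (cong (λ p → ℚ.∣ p ℚ.- seq y i ∣) (eq i)) (cong ℚ.∣_∣ (ℚP.+-inverseʳ (seq y i)))))
  (ℚP.<⇒≤ 0<δ)

seq-∑ : (f : Fin k → ℝ) → ∀ i → seq (Real.∑ f) i ≡ sumℚ (λ x → seq (f x) i)
seq-∑ {zero}  f i = refl
seq-∑ {suc k} f i = cong (seq (f zero) i ℚ.+_) (seq-∑ (f ∘ suc) i)

seq-∑-zero : (f : Fin k → ℝ) → ∀ i → (∀ x → seq (f x) i ≡ 0ℚ) → seq (Real.∑ f) i ≡ 0ℚ
seq-∑-zero {k} f i eq = trans (seq-∑ f i) (trans (sumℚ-cong eq) (sumℚ-zero k))

-- Every term of the logarithm series at 1 contains a power of `1 - 1`.
-plogp1≡0 : ∀ i → seq (Real.-plogp 1ℚ) i ≡ 0ℚ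
-plogp1≡0 i = trans (ℚP.*-identityˡ _) (mercator0 i)
  where
  mercator0 : ∀ i → Real.mercator (1ℚ ℚ.- 1ℚ) i ≡ 0ℚ
  mercator0 zero    = refl
  mercator0 (suc i) = cong₂ ℚ._+_ (mercator0 i)
    (trans (cong (ℚ._* (ℤ.+ 1 ℚ./ suc i)) (ℚP.*-zeroˡ (0ℚ ^ℚ i))) (ℚP.*-zeroˡ (ℤ.+ 1 ℚ./ suc i)))

module _ (X : Fin N → Fin k) (Y : Fin N → Fin l) where

  -- Given `Y = y` the variable `X` is constant, so each conditional probability is 0 or 1, and both
  -- values contribute nothing to the entropy.
  H-determined : (∀ {ω ω′} → Y ω ≡ Y ω′ → X ω ≡ X ω′) → H[ X ∣ Y ] Real.≃ Real.0ℝ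
  H-determined determined = seq≡⇒≃ {H[ X ∣ Y ]} {Real.0ℝ} λ i → seq-∑-zero _ i λ y →
    trans (cong (law Y y ℚ.*_) (seq-∑-zero _ i (λ x → log-term i x y))) (ℚP.*-zeroʳ (law Y y))
    where
    all-or-nothing : ∀ x y → #₂ X Y x y ≡ 0 ⊎ #₂ X Y x y ≡ # Y y
    all-or-nothing x y with any? (λ ω → (X ω ≟ x) ×-dec (Y ω ≟ y))
    ... | yes (ω , refl , refl) = inj₂ (count-cong (λ ω′ → (X ω′ ≟ X ω) ×-dec (Y ω′ ≟ Y ω))
      (λ ω′ → Y ω′ ≟ Y ω) proj₂ (λ eq → determined eq , eq) (Vec.allFin N))
    ... | no none = inj₁ (count-none (λ ω → (X ω ≟ x) ×-dec (Y ω ≟ y)) id (λ ω p → none (ω , p)))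
    log-term : ∀ i x y → seq (Real.-plogp (lawGiven X Y y x)) i ≡ 0ℚ
    log-term i x y with all-or-nothing x y
    ... | inj₁ eq rewrite eq | 0÷n≡0 (# Y y) = refl
    ... | inj₂ eq rewrite eq with # Y y
    -- No sample has this value of `Y`. By convention `0 ÷ 0` is 0, where `-plogp` is 0.
    ...   | zero  = refl
    ...   | suc j rewrite n÷n≡1 j = -plogp1≡0 i

  -- The pair of `X` and `Y` is an injection into a set of the same size `N`, so each pair of values
  -- occurs exactly once. Hence both variables are uniform and conditioning leaves the law of `X`
  -- unchanged. The entropy itself is never evaluated.
  H-independent : 0 < N → N ≡ k ℕ.* l → (∀ {ω ω′} → X ω ≡ X ω′ → Y ω ≡ Y ω′ → ω ≡ ω′) →
    H[ X ∣ Y ] Real.≃ H X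
  H-independent 0<N N≡kl injective = seq≡⇒≃ {H[ X ∣ Y ]} {H X} λ i → begin
    seq H[ X ∣ Y ] i
      ≡⟨ seq-∑ (λ y → law Y y Real.· entropy (lawGiven X Y y)) i ⟩
    sumℚ (λ y → law Y y ℚ.* seq (entropy (lawGiven X Y y)) i)
      ≡⟨ sumℚ-cong (λ y → cong (law Y y ℚ.*_) (same-entropy i y)) ⟩
    sumℚ (λ y → law Y y ℚ.* seq (H X) i)
      ≡⟨ sumℚ-*ʳ (seq (H X) i) (law Y) ⟨
    sumℚ (law Y) ℚ.* seq (H X) i
      ≡⟨ cong (ℚ._* seq (H X) i) total ⟩
    1ℚ ℚ.* seq (H X) i
      ≡⟨ ℚP.*-identityˡ _ ⟩
    seq (H X) i ∎
    where
    open ≡-Reasoning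

    #₂≡1 : ∀ x y → #₂ X Y x y ≡ 1
    #₂≡1 x y with injective⇒surjective′ N≡kl (λ ω → combine (X ω) (Y ω))
      (λ {ω} {ω′} eq → let X≡ , Y≡ = combine-injective (X ω) (Y ω) (X ω′) (Y ω′) eq in
         injective X≡ Y≡) (combine x y)
    ... | ω , eq with refl , refl ← combine-injective (X ω) (Y ω) x y eq =
      count-unique (λ ω′ → (X ω′ ≟ X ω) ×-dec (Y ω′ ≟ Y ω)) id ω (refl , refl)
        λ ω′ (X≡ , Y≡) → injective X≡ Y≡

    #X≡l : ∀ x → # X x ≡ l
    #X≡l x = trans (#₂-sumʳ X Y x) (trans (sumℕ-cong (#₂≡1 x))
      (trans (sumℕ-const l 1) (ℕP.*-identityʳ l)))

    #Y≡k : ∀ y → # Y y ≡ k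
    #Y≡k y = trans (#₂-sumˡ X Y y) (trans (sumℕ-cong (λ x → #₂≡1 x y))
      (trans (sumℕ-const k 1) (ℕP.*-identityʳ k)))

    ÷-ratio : ∀ {N} k l → 0 < N → N ≡ k ℕ.* l → 1 ÷ k ≡ l ÷ N
    ÷-ratio {suc N} (suc k) l _ N≡ = ÷-cross {1} {k} {l} {N}
      (trans (ℕP.*-identityˡ (suc N)) (trans N≡ (ℕP.*-comm (suc k) l)))
    ÷-ratio {suc N} zero l _ ()

    same-entropy : ∀ i y → seq (entropy (lawGiven X Y y)) i ≡ seq (H X) i
    same-entropy i y = trans (seq-∑ (Real.-plogp ∘ lawGiven X Y y) i) (trans
      (sumℚ-cong (λ x → cong (λ p → seq (Real.-plogp p) i) (same-law x)))
      (sym (seq-∑ (Real.-plogp ∘ law X) i)))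
      where
      same-law : ∀ x → lawGiven X Y y x ≡ law X x
      same-law x = begin
        #₂ X Y x y ÷ # Y y ≡⟨ cong₂ _÷_ (#₂≡1 x y) (#Y≡k y) ⟩
        1 ÷ k              ≡⟨ ÷-ratio k l 0<N N≡kl ⟩
        l ÷ N              ≡⟨ cong (_÷ N) (#X≡l x) ⟨
        # X x ÷ N          ∎

    total : sumℚ (law Y) ≡ 1ℚ
    total = begin
      sumℚ (law Y)       ≡⟨ ÷-sum (# Y) N ⟩
      sumℕ (# Y) ÷ N     ≡⟨ cong (_÷ N) (trans (sumℕ-cong #Y≡k) (sumℕ-const l k)) ⟩
      (l ℕ.* k) ÷ N      ≡⟨ cong (_÷ N) (trans (ℕP.*-comm l k) (sym N≡kl)) ⟩
      N ÷ N              ≡⟨ self-÷ 0<N ⟩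
      1ℚ                 ∎

-- Threshold schemes

hyperplane-bound : ∀ q E → hyperplane q E ℕ.* q ≤ q ^ E
hyperplane-bound q zero    = z≤n
hyperplane-bound q (suc E) = ℕP.≤-reflexive (ℕP.*-comm (q ^ E) q)

0<^ : ∀ {q} → 0 < q → ∀ E → 0 < q ^ E
0<^ {suc q} _ E = ℕP.m^n>0 (suc q) E

÷-≤ : ∀ {a b c d} → a ℕ.* d ≤ c ℕ.* b → 0 < b → 0 < d → a ÷ b ℚ.≤ c ÷ d
÷-≤ {a} {suc b} {c} {suc d} le _ _ = ℚP.toℚᵘ-cancel-≤
  (ℚᵘP.≤-respˡ-≃ (ℚᵘP.≃-sym (ℚP.toℚᵘ-fromℚᵘ (ℚᵘ.mkℚᵘ (ℤ.+ a) b)))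
  (ℚᵘP.≤-respʳ-≃ (ℚᵘP.≃-sym (ℚP.toℚᵘ-fromℚᵘ (ℚᵘ.mkℚᵘ (ℤ.+ c) d)))
    (ℚᵘ.*≤* (subst₂ ℤ._≤_ (ℤP.pos-* a (suc d)) (ℤP.pos-* c (suc b)) (ℤ.+≤+ le)))))

positive⇒÷ : ∀ δ → 0ℚ ℚ.< δ → ∃ λ a → ∃ λ d → 0 < a × 0 < d × δ ≡ a ÷ d
positive⇒÷ δ@(mkℚ (ℤ.+ suc a) d _) _ = suc a , suc d , s≤s z≤n , s≤s z≤n , sym (ℚP.↥p/↧p≡p δ)
positive⇒÷ (mkℚ (ℤ.+ zero) _ _)  0<δ = contradiction (ℚP.drop-*<* 0<δ) (ℤP.<-irrefl refl)
positive⇒÷ (mkℚ ℤ.-[1+ _ ] _ _)  0<δ with () ← ℚP.drop-*<* 0<δ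

-- A hyperplane-sized set is at most a fraction `1 / q` of the space, so the bad fraction is at most
-- `C / q`. The threshold is chosen before `q` and `E`, from `C` and a positive rational δ that is
-- eventually a lower bound for η.
with-high-probability : ∀ {a b} C (η : ℝ) → Real.0ℝ Real.< η →
  ∃ λ q₀ → ∀ {q E} {P : Fin (q ^ E) → Set a} {Bad : Fin (q ^ E) → Set b} → q₀ ≤ q → (∀ ω → Dec (Bad ω)) →
  AtMost (C ℕ.* hyperplane q E) Bad → (∀ {ω} → ¬ Bad ω → P ω) →
  ℙ[ P ]≥ (Real.1ℝ Real.- η)
with-high-probability C η (δ , 0<δ , M , δ≤η) with positive⇒÷ δ 0<δ
-- Since δ is `a / d` with `a` positive, `q ≥ C * d` gives `C / q ≤ 1 / d ≤ δ`. The successor keeps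
-- `q` positive and the sample space inhabited.
... | a , d , 0<a , 0<d , δ≡ = suc (C ℕ.* d) , λ {q} {E} q₀≤q Bad? atMost good →
  ∁ (subset Bad?) ,
  (λ ω∈ → good λ bad → x∈∁p⇒x∉p ω∈ (∈-subset⁺ Bad? bad)) ,
  λ δ′ 0<δ′ → M , λ {i} M≤i →
    let
      B = subset Bad?
      K = q ^ E
      h = hyperplane q E
      0<K = 0<^ (ℕP.≤-trans (s≤s z≤n) q₀≤q) E

      few : ∣ B ∣ ℕ.* d ≤ a ℕ.* K
      few = let open ℕP.≤-Reasoning in begin
        ∣ B ∣ ℕ.* d     ≤⟨ ℕP.*-monoˡ-≤ d (∣ B ∣≤ (∈-subset⁻ Bad?) atMost) ⟩
        C ℕ.* h ℕ.* d   ≡⟨ cong (ℕ._* d) (ℕP.*-comm C h) ⟩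
        h ℕ.* C ℕ.* d   ≡⟨ ℕP.*-assoc h C d ⟩
        h ℕ.* (C ℕ.* d) ≤⟨ ℕP.*-monoʳ-≤ h (ℕP.≤-trans (ℕP.n≤1+n (C ℕ.* d)) q₀≤q) ⟩
        h ℕ.* q         ≤⟨ hyperplane-bound q E ⟩
        K               ≡⟨ ℕP.*-identityˡ K ⟨
        1 ℕ.* K         ≤⟨ ℕP.*-monoˡ-≤ K 0<a ⟩
        a ℕ.* K         ∎

      complement : ∣ ∁ B ∣ ÷ K ℚ.+ ∣ B ∣ ÷ K ≡ 1ℚ
      complement = let open ≡-Reasoning in begin
        ∣ ∁ B ∣ ÷ K ℚ.+ ∣ B ∣ ÷ K ≡⟨ ÷-+ ∣ ∁ B ∣ ∣ B ∣ K ⟩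
        (∣ ∁ B ∣ ℕ.+ ∣ B ∣) ÷ K   ≡⟨ cong (λ z → (z ℕ.+ ∣ B ∣) ÷ K) (∣∁p∣≡n∸∣p∣ B) ⟩
        (K ∸ ∣ B ∣ ℕ.+ ∣ B ∣) ÷ K ≡⟨ cong (_÷ K) (ℕP.m∸n+n≡m (∣p∣≤n B)) ⟩
        K ÷ K                     ≡⟨ self-÷ 0<K ⟩
        1ℚ                        ∎

      g = ∣ ∁ B ∣ ÷ K
    in let open ℚP.≤-Reasoning in begin
      1ℚ ℚ.+ ℚ.- 1ℚ ℚ.* seq η i
        ≡⟨ cong₂ ℚ._+_ complement (ℚP.neg-distribˡ-* 1ℚ (seq η i)) ⟨
      (g ℚ.+ ∣ B ∣ ÷ K) ℚ.- (1ℚ ℚ.* seq η i)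
        ≡⟨ cong (λ z → (g ℚ.+ ∣ B ∣ ÷ K) ℚ.- z) (ℚP.*-identityˡ (seq η i)) ⟩
      (g ℚ.+ ∣ B ∣ ÷ K) ℚ.- seq η i
        ≤⟨ ℚP.+-mono-≤ (ℚP.+-monoʳ-≤ g (ℚP.≤-trans (÷-≤ few 0<K 0<d) (ℚP.≤-reflexive (sym δ≡))))
             (ℚP.neg-antimono-≤ (ℚP.≤-trans (ℚP.≤-reflexive (sym (ℚP.+-identityˡ δ))) (δ≤η M≤i))) ⟩
      (g ℚ.+ δ) ℚ.- δ
        ≡⟨ ℚP.+-assoc g δ (ℚ.- δ) ⟩
      g ℚ.+ (δ ℚ.- δ)
        ≡⟨ cong (g ℚ.+_) (ℚP.+-inverseʳ δ) ⟩
      g ℚ.+ 0ℚ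
        ≤⟨ ℚP.+-monoʳ-≤ g (ℚP.<⇒≤ 0<δ′) ⟩
      g ℚ.+ δ′ ∎

-- Allowed is _≢ s for the linkings of the graph without s.
record Connection (G : Network v t n) (Allowed : Fin t → Set) (T : Subset n) : Set where
  open Network G
  open Routings G
  field
    σ           : Fin ∣ T ∣ → Fin t
    σ-injective : Injective _≡_ _≡_ σ
    allowed     : ∀ r → Allowed (σ r)
    routing     : Routing σ
    end≡output  : ∀ r → Routing.end routing r ≡ output (members T r)

module _ {v′ t′} (G′ : Network v′ t′ n) (G : Network v t n) where

  private
    module G′ = Network G′
  open Network G
  open Routings G

  module _ (φ : Fin v′ → Fin v) (φ-injective : Injective _≡_ _≡_ φ)
           (φ-edge : ∀ {u w} → G′._⟶_ u w → φ u ⟶ φ w) where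

    private
      -- The accumulator turns a path, which grows at its start, into a walk, which grows at its
      -- end.
      extend : ∀ {a u w} → Walk a (φ u) → G′.Path u w → Walk a (φ w)
      extend p ε       = p
      extend p (e ◅ q) = extend (p ▻ φ-edge e) q

      start∈ : ∀ {u w} (q : G′.Path u w) → u ∈ₗ G′.vertices q
      start∈ ε       = Any.here refl
      start∈ (_ ◅ _) = Any.here refl

      extend⊆ : ∀ {a u w x} (p : Walk a (φ u)) (q : G′.Path u w) → x ∈ʷ extend p q →
        x ∈ʷ p ⊎ ∃ λ y → y ∈ₗ G′.vertices q × φ y ≡ x
      extend⊆ p ε       x∈ = inj₁ x∈
      extend⊆ p (e ◅ q) x∈ with extend⊆ (p ▻ φ-edge e) q x∈
      ... | inj₁ (inj₁ x∈p) = inj₁ x∈p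
      ... | inj₁ (inj₂ x≡)  = inj₂ (_ , Any.there (start∈ q) , sym x≡)
      ... | inj₂ (y , y∈ , eq) = inj₂ (y , Any.there y∈ , eq)

      image : ∀ {a u w} → φ u ≡ a → G′.Path u w → Walk a (φ w)
      image refl q = extend [] q

      image⊆ : ∀ {a u w x} (eq : φ u ≡ a) (q : G′.Path u w) → x ∈ʷ image eq q →
        ∃ λ y → y ∈ₗ G′.vertices q × φ y ≡ x
      image⊆ refl q x∈ with extend⊆ [] q x∈
      ... | inj₁ refl = _ , start∈ q , refl
      ... | inj₂ y    = y

    -- Stated for an embedding `φ` of graphs to cover both `G` itself and the graph without `s`.
    -- Injectivity of `φ` keeps the paths disjoint.
    linking⇒connection : ∀ {Allowed T} (ι : Fin t′ → Fin t) → Injective _≡_ _≡_ ι →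
      (∀ i → Allowed (ι i)) → (∀ i → φ (G′.input i) ≡ input (ι i)) →
      (∀ j → φ (G′.output j) ≡ output j) → Linking G′ T → Connection G Allowed T
    linking⇒connection {T = T} ι ι-injective allowed φ-input φ-output linking = record
      { σ           = ι ∘ start
      ; σ-injective = start-injective ∘ ι-injective
      ; allowed     = allowed ∘ start
      ; routing     = record
        { end      = λ r → φ (G′.output (members T r))
        ; walk     = λ r → image (φ-input (start r)) (path r)
        ; disjoint = meet
        }
      ; end≡output  = λ r → φ-output (members T r)
      }
      where
      open Linking linking
      meet : ∀ {r r′ x} → x ∈ʷ image (φ-input (start r)) (path r) →
        x ∈ʷ image (φ-input (start r′)) (path r′) → r ≡ r′
      meet {r} {r′} x∈ x∈′
        with image⊆ (φ-input (start r)) (path r) x∈ | image⊆ (φ-input (start r′)) (path r′) x∈′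
      ... | y , y∈ , refl | y′ , y′∈ , eq with r ≟ r′
      ...   | yes r≡r′ = r≡r′
      ...   | no r≢r′  = ⊥-elim (disjoint r≢r′
                (y∈ , subst (_∈ₗ G′.vertices (path r′)) (φ-injective eq) y′∈))

-- All sets of `k` outputs at once

module _ (G : Network v t n) {Allowed : Fin t → Set}
         (connect : ∀ T → ∣ T ∣ ≡ k → Connection G Allowed T) where

  open Network G
  open Connection
  open Routings G using (module Routing)

  private
    length : ∀ {T} → Dec (∣ T ∣ ≡ k) → ℕ
    length {T} (yes h) = Routing.totalLength (routing (connect T h))
    length     (no _)  = 0

    lengthAt : Subset n → ℕ
    lengthAt T = length {T} (∣ T ∣ ℕP.≟ k)

  -- The constant `L` of the union bound. It depends on the graph and the chosen paths but not on
  -- the field, so the threshold for `q` can be uniform.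
  complexity : ℕ
  complexity = sumSubsets lengthAt

  module _ {c ℓ₁ ℓ₂} (F : FiniteField c ℓ₁ ℓ₂) where

    open FiniteField F using (order)
    open RandomCoefficients F G

    BadAt : Fin (order ^ ∣E∣) → Subset n → Set _
    BadAt ω T = ∃ λ (h : ∣ T ∣ ≡ k) → ¬ Good (routing (connect T h)) ω

    Bad : Fin (order ^ ∣E∣) → Set _
    Bad ω = ∃ (BadAt ω)

    Bad? : ∀ ω → Dec (Bad ω)
    Bad? ω = anySubset? badAt?
      where
      badAt? : ∀ T → Dec (BadAt ω T)
      badAt? T with ∣ T ∣ ℕP.≟ k
      ... | no ≢k = no (≢k ∘ proj₁)
      -- The routing is chosen from a proof of the size of `T`. Any two such proofs are equal, so
      -- the choice is the same.
      ... | yes h = map′ (h ,_)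
        (λ (h′ , bad) → subst (λ h → ¬ Good (routing (connect T h)) ω) (ℕP.≡-irrelevant h′ h) bad)
        (¬? (Good? (routing (connect T h)) ω))

    Bad-atMost : AtMost (complexity ℕ.* hyperplane order ∣E∣) Bad
    Bad-atMost = subst (λ N → AtMost N Bad) (sumSubsets-*ʳ (hyperplane order ∣E∣) lengthAt)
      (AtMost-⋃ (λ T → lengthAt T ℕ.* hyperplane order ∣E∣) λ T → atMost T (∣ T ∣ ℕP.≟ k))
      where
      atMost : ∀ T (d : Dec (∣ T ∣ ≡ k)) →
        AtMost (length {T} d ℕ.* hyperplane order ∣E∣) (λ ω → BadAt ω T)
      atMost T (no ≢k) = AtMost-empty λ ω (h , _) → ≢k h
      atMost T (yes h) = AtMost-⊆
        (λ ω (h′ , bad) → subst (λ h → ¬ Good (routing (connect T h)) ω) (ℕP.≡-irrelevant h′ h) bad)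
        (bad-at-most (σ-injective (connect T h)) (routing (connect T h)) _ refl)

    ¬Bad⇒Good : ∀ {ω} → ¬ Bad ω → ∀ T (h : ∣ T ∣ ≡ k) → Good (routing (connect T h)) ω
    ¬Bad⇒Good {ω} ¬bad T h = decidable-stable (Good? (routing (connect T h)) ω)
      λ bad → ¬bad (T , h , bad)

-- Correctness and privacy of a good circuit

module Scheme {c ℓ₁ ℓ₂} (F : FiniteField c ℓ₁ ℓ₂) (G : Network v t n) where

  open FiniteField F hiding (zero) renaming (refl to ≈-refl; sym to ≈-sym; trans to ≈-trans)
  open FiniteFieldProperties F
  open Network G
  open Circuit F G
  open RandomCoefficients F G

  0<order : 0 < order
  0<order = inhabited (index 0#)
    where
    inhabited : ∀ {q} → Fin q → 0 < q
    inhabited {suc q} _ = s≤s z≤n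

  module _ {Allowed T} (connection : Connection G Allowed T) where

    open Connection connection

    -- The difference of the two input vectors vanishes off `σ`, so it is embedded from the starts
    -- of the walks. By linearity it lies in the trivial kernel.
    inputs-determined : ∀ κ → TrivialKernel (transfer κ routing) → ∀ x x′ →
      (∀ i → (∀ r → σ r ≢ i) → x i ≈ x′ i) →
      (∀ r → value F G κ x (output (members T r)) ≈ value F G κ x′ (output (members T r))) →
      ∀ i → x i ≈ x′ i
    inputs-determined κ trivial x x′ off same i with any? (λ r → σ r ≟ i)
    ... | no none = off i λ r eq → none (r , eq)
    ... | yes (r , refl) = difference≈0 (trivial (d ∘ σ) vanish r)
      where
      open SetoidReasoning setoid
      d : Fin t → Carrier
      d i = x i - x′ i
      x≈y⇒d≈0 : ∀ {a b} → a ≈ b → a - b ≈ 0#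
      x≈y⇒d≈0 {a} {b} a≈b = ≈-trans (+-cong a≈b ≈-refl) (-‿inverseʳ b)
      vanish : ∀ r → transfer κ routing (d ∘ σ) r ≈ 0#
      vanish r = begin
        value F G κ (embed σ (d ∘ σ)) (Routings.Routing.end routing r)
          ≡⟨ cong (value F G κ (embed σ (d ∘ σ))) (end≡output r) ⟩
        value F G κ (embed σ (d ∘ σ)) (output (members T r))
          ≈⟨ value-cong κ (embed-restrict σ (λ i miss → x≈y⇒d≈0 (off i miss))) _ ⟨
        value F G κ d (output (members T r))
          ≈⟨ linear-- (value-linear κ) x x′ _ ⟩
        value F G κ x (output (members T r)) - value F G κ x′ (output (members T r))
          ≈⟨ x≈y⇒d≈0 (same r) ⟩
        0# ∎

  shares-injective : ∀ κ T ρ ρ′ → shares F G κ T ρ ≡ shares F G κ T ρ′ → ∀ r →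
    value F G κ (inputValues F G κ ρ) (output (members T r)) ≈
    value F G κ (inputValues F G κ ρ′) (output (members T r))
  shares-injective κ T ρ ρ′ eq r = code-injective eq r

  -- There are as many walks as inputs, so every input starts a walk and the shares determine all
  -- inputs, the secret included.
  correctness : ∀ {Allowed T} → ∣ T ∣ ≡ t → (C : Connection G Allowed T) → ∀ κ →
    TrivialKernel (transfer κ (Connection.routing C)) → ∀ s →
    H[ secret F G κ s ∣ shares F G κ T ] Real.≃ Real.0ℝ
  correctness {T = T} ∣T∣≡t C κ trivial s =
    H-determined (secret F G κ s) (shares F G κ T) determined
    where
    open Connection C
    covered : ∀ {x x′ : Fin t → Carrier} i → (∀ r → σ r ≢ i) → x i ≈ x′ i
    covered i miss with injective⇒surjective′ ∣T∣≡t σ σ-injective i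
    ... | r , eq = contradiction eq (miss r)
    determined : ∀ {ρ ρ′} → shares F G κ T ρ ≡ shares F G κ T ρ′ →
      secret F G κ s ρ ≡ secret F G κ s ρ′
    determined {ρ} {ρ′} eq = index-cong (inputs-determined C κ trivial
      (inputValues F G κ ρ) (inputValues F G κ ρ′) covered (shares-injective κ T ρ ρ′ eq) s)

-- The `t` walks use every input except `s`, so secret and shares together determine the sample. The
-- sample space has as many points as there are pairs of secret and shares, which gives independence
-- by counting.
privacy : ∀ {c ℓ₁ ℓ₂} (F : FiniteField c ℓ₁ ℓ₂) (G : Network v (suc t) n) (s : Fin (suc t)) →
  ∀ {T} → ∣ T ∣ ≡ t → (C : Connection G (_≢ s) T) → ∀ κ →
  FiniteFieldProperties.TrivialKernel F (RandomCoefficients.transfer F G κ (Connection.routing C)) →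
  H[ secret F G κ s ∣ shares F G κ T ] Real.≃ H (secret F G κ s)
privacy {t = t} F G s {T} ∣T∣≡t C κ trivial = H-independent (secret F G κ s) (shares F G κ T)
  (0<^ 0<order (suc t)) (cong (λ k → order ℕ.* order ^ k) (sym ∣T∣≡t)) injective
  where
  open FiniteField F using (order; _≈_; index)
  open FiniteFieldProperties F
  open Scheme F G
  open Connection C
  s≢σ : ∀ r → s ≢ σ r
  s≢σ r eq = allowed r (sym eq)
  -- After `s` is punched out, `σ` becomes an injection between sets of size `t`, hence surjective,
  -- and reaches every input other than `s`.
  missed : ∀ i → (∀ r → σ r ≢ i) → s ≡ i
  missed i miss with s ≟ i
  ... | yes s≡i = s≡i
  ... | no s≢i with injective⇒surjective′ ∣T∣≡t (λ r → punchOut (s≢σ r))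
                      (λ eq → σ-injective (punchOut-injective (s≢σ _) (s≢σ _) eq)) (punchOut s≢i)
  ...   | r , eq = contradiction (punchOut-injective (s≢σ r) s≢i eq) (miss r)
  injective : ∀ {ρ ρ′} → secret F G κ s ρ ≡ secret F G κ s ρ′ →
    shares F G κ T ρ ≡ shares F G κ T ρ′ → ρ ≡ ρ′
  injective {ρ} {ρ′} secret≡ shares≡ = point-injective {m = suc t}
    (inputs-determined C κ trivial (inputValues F G κ ρ) (inputValues F G κ ρ′)
      (λ i miss → subst (λ i → inputValues F G κ ρ i ≈ inputValues F G κ ρ′ i)
        (missed i miss) (index-injective secret≡))
      (shares-injective κ T ρ ρ′ shares≡))

module _ (G : Network v t n) where

  concentrator⇒connection : IsConcentrator G → ∀ T → ∣ T ∣ ≡ t → Connection G (λ _ → ⊤) T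
  concentrator⇒connection concentrator T ∣T∣≡t = linking⇒connection G G id id id id id
    (λ _ → tt) (λ _ → refl) (λ _ → refl) (concentrator T ∣T∣≡t)

module _ (G : Network (suc v) (suc t) n) (s : Fin (suc t))
         (s-notOutput : ¬ IsOutput G (Network.input G s)) where

  open Network G

  deleted⇒connection : IsConcentrator (deleteInput G s s-notOutput) →
    ∀ T → ∣ T ∣ ≡ t → Connection G (_≢ s) T
  deleted⇒connection concentrator T ∣T∣≡t =
    linking⇒connection (deleteInput G s s-notOutput) G
      (punchIn (input s)) (punchIn-injective (input s) _ _) id
      (punchIn s) (punchIn-injective s _ _) (punchInᵢ≢i s)
      (λ i → punchIn-punchOut _) (λ j → punchIn-punchOut _) (concentrator T ∣T∣≡t)

module _ (G : Network v (suc t) n) (s : Fin (suc t))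
         (connect : ∀ T → ∣ T ∣ ≡ suc t → Connection G (λ _ → ⊤) T)
         (connect′ : ∀ T → ∣ T ∣ ≡ t → Connection G (_≢ s) T) where

  open Network G

  module _ {c ℓ₁ ℓ₂} (F : FiniteField c ℓ₁ ℓ₂) where

    open FiniteField F using (order)

    AnyBad : Fin (order ^ ∣E∣) → Set _
    AnyBad ω = Bad G connect F ω ⊎ Bad G connect′ F ω

    computes : ∀ ω → ¬ AnyBad ω → ComputesThresholdScheme F G (coefficients F G ω) s
    computes ω ¬bad = record
      { correctness = λ T h → Scheme.correctness F G h (connect T h) (coefficients F G ω)
          (¬Bad⇒Good G connect F (λ bad → ¬bad (inj₁ bad)) T h) s
      ; privacy     = λ T h → privacy F G s h (connect′ T h) (coefficients F G ω)
          (¬Bad⇒Good G connect′ F (λ bad → ¬bad (inj₂ bad)) T h)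
      }

    AnyBad-atMost :
      AtMost ((complexity G connect ℕ.+ complexity G connect′) ℕ.* hyperplane order ∣E∣) AnyBad
    AnyBad-atMost = subst (λ N → AtMost N AnyBad)
      (sym (ℕP.*-distribʳ-+ (hyperplane order ∣E∣) (complexity G connect) (complexity G connect′)))
      (AtMost-∪ (Bad-atMost G connect F) (Bad-atMost G connect′ F))

theorem2 : ∀ (c ℓ₁ ℓ₂ : Level) (v t n : ℕ) → 1 ≤ t → t ≤ n →
    (G : Network v t n) (s : Fin t) →
    (s-notOutput : ¬ IsOutput G (Network.input G s)) →
    IsConcentrator G →
    IsConcentrator (deleteInput G s s-notOutput) →
    ∀ (η : ℝ) → Real.0ℝ Real.< η →
    ∃ λ (q₀ : ℕ) → ∀ (F : FiniteField c ℓ₁ ℓ₂) → q₀ ≤ FiniteField.order F →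
    ℙ[ (λ ω → ComputesThresholdScheme F G (coefficients F G ω) s) ]≥ (Real.1ℝ Real.- η)
-- The vertex `input s` excludes an empty graph; with `v` and `t` successors, `deleteInput`
-- computes.
theorem2 c ℓ₁ ℓ₂ zero    t       n _ _ G s _ _ _ _ _ with () ← Network.input G s
theorem2 c ℓ₁ ℓ₂ (suc v) (suc t) n _ _ G s s-notOutput concentrator concentrator′ η 0<η =
  -- The threshold comes from the two complexities, for sets of size `t + 1` and of size `t`, before
  -- any field is given.
  map₂ (λ bound F q₀≤order → bound {FiniteField.order F} {Network.∣E∣ G}
         {λ ω → ComputesThresholdScheme F G (coefficients F G ω) s} {AnyBad G s connect connect′ F}
         q₀≤order
         (λ ω → Bad? G connect F ω ⊎-dec Bad? G connect′ F ω)
         (AnyBad-atMost G s connect connect′ F)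
         (λ {ω} → computes G s connect connect′ F ω))
    (with-high-probability (complexity G connect ℕ.+ complexity G connect′) η 0<η)
  where
  connect  = concentrator⇒connection G concentrator
  connect′ = deleted⇒connection G s s-notOutput concentrator′
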